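{- Let $\Gamma_1$ and $\Gamma_2$ be subgraphs of a finite loopless graph $\Gamma$ (multiple edges allowed) such that $\Gamma=\Gamma_1\cup\Gamma_2$, $|E(\Gamma_1)\cap E(\Gamma_2)|\le 3$, and the edge set $E(\Gamma_1)\cap E(\Gamma_2)$ induces a connected subgraph of $\Gamma$. If both $\Gamma_1$ and $\Gamma_2$ admit nowhere-zero $4$-flows, then $\Gamma$ admits a nowhere-zero $4$-flow.
   Context: An orientation $\mathcal D$ of a graph assigns each edge one of its two directions; $\mathcal D^+(v)$ (resp. $\mathcal D^-(v)$) is the set of edges with tail (resp. head) at $v$. A nowhere-zero $4$-flow is a pair $(\mathcal D,\varphi)$ with $\varphi:E(\Gamma)\to\mathbb Z$, $0<|\varphi(e)|<4$ for all edges $e$, and $\sum_{e\in\mathcal D^+(v)}\varphi(e)=\sum_{e\in\mathcal D^-(v)}\varphi(e)$ for every vertex $v$; equivalently one may use $\mathbb Z_4$-valued nowhere-zero flows. The subgraph induced by an edge set consists of those edges together with their end vertices. -}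

module Defs where

open import Data.Nat using (ℕ; zero; suc; _<_)
open import Data.Bool using (Bool; true; false; if_then_else_)
open import Data.Fin using (Fin; zero; suc; _≟_)
open import Data.Fin.Subset using (Subset; _∈_; ⊤)
open import Data.Fin.Subset.Properties using (∈⊤)
open import Data.Vec using (lookup)
open import Data.Integer using (ℤ; 0ℤ; _+_; ∣_∣)
open import Data.Product using (_×_; _,_; proj₁; proj₂; ∃-syntax)
open import Data.Sum using (_⊎_)
open import Relation.Nullary using (¬_; does)
open import Relation.Binary.PropositionalEquality using (_≡_)

-- A finite loopless multigraph with vertex set Fin n and edge set Fin m;
-- each edge has an (unordered) pair of distinct end vertices, stored as a pair.
record Graph : Set where
  field
    n m      : ℕ
    ends     : Fin m → Fin n × Fin n
    loopless : ∀ e → ¬ (proj₁ (ends e) ≡ proj₂ (ends e))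
open Graph public

record Subgraph (Γ : Graph) : Set where
  field
    V : Subset (n Γ)
    E : Subset (m Γ)
    closed : ∀ e → e ∈ E → proj₁ (ends Γ e) ∈ V × proj₂ (ends Γ e) ∈ V
open Subgraph public

Σℤ : ∀ {k} → (Fin k → ℤ) → ℤ
Σℤ {zero}  f = 0ℤ
Σℤ {suc k} f = f zero + Σℤ (λ i → f (suc i))

-- Orientation: D e = true means edge e is directed from proj₁ (ends e) to proj₂ (ends e).
Orientation : Graph → Set
Orientation Γ = Fin (m Γ) → Bool

tail : (Γ : Graph) → Orientation Γ → Fin (m Γ) → Fin (n Γ)
tail Γ D e = if D e then proj₁ (ends Γ e) else proj₂ (ends Γ e)

head : (Γ : Graph) → Orientation Γ → Fin (m Γ) → Fin (n Γ)
head Γ D e = if D e then proj₂ (ends Γ e) else proj₁ (ends Γ e)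

memb : ∀ {k} → Subset k → Fin k → Bool
memb S i = lookup S i

outSum : (Γ : Graph) → Subset (m Γ) → Orientation Γ → (Fin (m Γ) → ℤ) → Fin (n Γ) → ℤ
outSum Γ E D φ v =
  Σℤ (λ e → if memb E e then (if does (tail Γ D e ≟ v) then φ e else 0ℤ) else 0ℤ)

inSum : (Γ : Graph) → Subset (m Γ) → Orientation Γ → (Fin (m Γ) → ℤ) → Fin (n Γ) → ℤ
inSum Γ E D φ v =
  Σℤ (λ e → if memb E e then (if does (head Γ D e ≟ v) then φ e else 0ℤ) else 0ℤ)

-- A nowhere-zero 4-flow (D, φ) on the subgraph H of Γ (φ is only relevant on edges of H).
record NZ4Flow (Γ : Graph) (H : Subgraph Γ) : Set where
  field
    D         : Orientation Γ
    φ         : Fin (m Γ) → ℤ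
    nowhere0  : ∀ e → e ∈ E H → 0 < ∣ φ e ∣ × ∣ φ e ∣ < 4
    conserve  : ∀ v → v ∈ V H → outSum Γ (E H) D φ v ≡ inSum Γ (E H) D φ v

whole : (Γ : Graph) → Subgraph Γ
whole Γ = record { V = ⊤ ; E = ⊤ ; closed = λ e _ → ∈⊤ , ∈⊤ }

InInduced : (Γ : Graph) → Subset (m Γ) → Fin (n Γ) → Set
InInduced Γ S v = ∃[ e ] (e ∈ S × (proj₁ (ends Γ e) ≡ v ⊎ proj₂ (ends Γ e) ≡ v))

data Reach (Γ : Graph) (S : Subset (m Γ)) : Fin (n Γ) → Fin (n Γ) → Set where
  here : ∀ {u} → Reach Γ S u u
  step : ∀ {u w v} (e : Fin (m Γ)) → e ∈ S →
         ((proj₁ (ends Γ e) ≡ u × proj₂ (ends Γ e) ≡ w) ⊎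
          (proj₂ (ends Γ e) ≡ u × proj₁ (ends Γ e) ≡ w)) →
         Reach Γ S w v → Reach Γ S u v

InducesConnected : (Γ : Graph) → Subset (m Γ) → Set
InducesConnected Γ S = ∀ u v → InInduced Γ S u → InInduced Γ S v → Reach Γ S u v

{-# OPTIONS --safe #-}
module Submission where

-- A nowhere-zero 4-flow amounts to a nowhere-zero flow with values in V₄ = F₂ × F₂, i.e. to two even edge
-- sets covering all edges: an even edge set carries an integer flow with values ±1 (Euler), so an integer
-- flow f splits as h + 2k with h ≡ f mod 2 and values of h in {0, ±1}, giving the pair (f mod 2, k mod 2);
-- conversely a pair of even sets with ±1-flows h and k gives h + 2k.
--
-- For V₄-flows φ₁, φ₂ on the two parts, φ₁ + M φ₂ with M ∈ GL₂(F₂) works as soon as it has no zero on the set S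
-- of common edges. Such an M exists unless, up to exchanging the parts, S consists of three edges on which φ₁
-- is constant and φ₂ injective. If then both ends of some e ∈ S meet other edges of S, add φ₂(e) to φ₂ along
-- a suitable even set; a zero created at e is harmless since φ₁(e) ≠ 0. Otherwise, S being connected, its three
-- edges share a vertex, and φ₁ is changed along an even set containing some, but not all, of them.
open import Defs
open import Data.Nat using (_≤_)
open import Data.Fin.Subset using (_∩_; _∪_; ⊤; ∣_∣)
open import Relation.Binary.PropositionalEquality using (_≡_)
open import Algebra.Bundles using (CommutativeRing)
open import Algebra.Properties.AbelianGroup using (∙-cancelʳ)
open import Data.Bool using (Bool; true; false; not; if_then_else_; _∧_; _∨_; _xor_)
open import Data.Bool.Properties using (xor-∧-commutativeRing; xor-same; xor-comm; xor-identityʳ; xor-annihilates-not;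
  not-distribˡ-xor; not-distribʳ-xor; ∧-comm; ∧-identityʳ; ∧-zeroʳ; ∨-zeroʳ; ¬-not)
open import Data.Fin using (Fin; zero; suc; _≟_)
open import Data.Fin.Properties using (any?)
open import Data.Fin.Subset using (Subset; _∈_; _∉_) renaming (_-_ to _without_)
open import Data.Fin.Subset.Properties using (_∈?_; nonempty?; x∈p⇒∣p-x∣<∣p∣; x∈p∧x≢y⇒x∈p-y;
  p─q⊆p; x∈p∩q⁺; x∈p∩q⁻; x∈p∪q⁻; ∈⊤; ∩-comm; ∪-comm)
open import Data.Integer using (ℤ; 0ℤ; 1ℤ; -1ℤ; +_; -[1+_]; _⊖_)
  renaming (_+_ to _+ℤ_; _*_ to _*ℤ_; -_ to -ℤ_; _-_ to _-ℤ_; ∣_∣ to ∥_∥)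
import Data.Integer.Properties as ℤₚ
open import Data.Nat using (ℕ; zero; suc; _<_; s≤s; z≤n) renaming (_+_ to _+ℕ_)
open import Data.Nat.Properties using (+-suc; ≤-trans; ≤-pred)
open import Data.Product using (_×_; _,_; proj₁; proj₂; ∃-syntax)
open import Data.Sum using (_⊎_; inj₁; inj₂) renaming (map to map-⊎)
open import Data.Vec using ([]; _∷_; lookup; replicate)
open import Data.Vec.Functional using (updateAt) renaming (_∷_ to _◂_)
open import Data.Vec.Functional.Properties using (updateAt-updates; updateAt-minimal)
open import Data.Vec.Properties using ([]=⇒lookup; lookup⇒[]=; lookup-replicate)
open import Function using (_∘_; const)
open import Level using (0ℓ)
open import Relation.Binary.PropositionalEquality as ≡ using (_≢_)
open import Relation.Nullary using (Dec; yes; no; does; ¬_; contradiction)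
open import Relation.Nullary.Decidable using (dec-true; dec-false; _×-dec_; _⊎-dec_; ¬?)

-- Boundaries of edge weights over a commutative ring

module Boundary (R : CommutativeRing 0ℓ 0ℓ) where
  open CommutativeRing R hiding (zero)
  open import Algebra.Properties.Semiring.Sum semiring public
  open import Relation.Binary.Reasoning.Setoid setoid

  δ : ∀ {n} → Fin n → Fin n → Carrier
  δ a v = if does (a ≟ v) then 1# else 0#

  ι : ∀ {n} → Fin n → Fin n → Fin n → Carrier
  ι a b v = δ a v - δ b v

  ∂ : ∀ {m n} (s t : Fin m → Fin n) → (Fin m → Carrier) → Fin n → Carrier
  ∂ s t g v = sum (λ e → g e * ι (s e) (t e) v)

  sum-single : ∀ {k} (j : Fin k) (x : Fin k → Carrier) →
               sum (λ i → if does (j ≟ i) then x i else 0#) ≈ x j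
  sum-single {suc k} zero x = trans (+-congˡ (sum-replicate-zero k)) (+-identityʳ _)
  sum-single (suc j) x = trans (+-identityˡ _) (sum-single j (x ∘ suc))

  ∂-+ : ∀ {m n} (s t : Fin m → Fin n) g h v →
        ∂ s t (λ e → g e + h e) v ≈ ∂ s t g v + ∂ s t h v
  ∂-+ s t g h v = trans (sum-cong-≋ (λ e → distribʳ (ι (s e) (t e) v) (g e) (h e)))
                        (∑-distrib-+ (λ e → g e * ι (s e) (t e) v) (λ e → h e * ι (s e) (t e) v))

  ∂-single : ∀ {m n} (s t : Fin m → Fin n) j v →
             ∂ s t (δ j) v ≈ ι (s j) (t j) v
  ∂-single s t j v = trans (sum-cong-≋ term) (sum-single j (λ e → ι (s e) (t e) v))
    where
    term : ∀ e → δ j e * ι (s e) (t e) v ≈ (if does (j ≟ e) then ι (s e) (t e) v else 0#)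
    term e with does (j ≟ e)
    ... | true  = *-identityˡ _
    ... | false = zeroˡ _

  -- The two sums differ only in the summand of `j`, whose incidence at `v` changes by `d`.
  ∂-reroute : ∀ {m n} (s t s′ t′ : Fin m → Fin n) g j v d →
              (∀ e → e ≢ j → s′ e ≡ s e × t′ e ≡ t e) →
              ι (s′ j) (t′ j) v ≈ ι (s j) (t j) v + d →
              ∂ s′ t′ g v ≈ ∂ s t g v + g j * d
  ∂-reroute s t s′ t′ g j v d same moved = begin
    ∂ s′ t′ g v
      ≈⟨ sum-cong-≋ term ⟩
    sum (λ e → g e * ι (s e) (t e) v + (if does (j ≟ e) then g e * d else 0#))
      ≈⟨ ∑-distrib-+ (λ e → g e * ι (s e) (t e) v) (λ e → if does (j ≟ e) then g e * d else 0#) ⟩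
    ∂ s t g v + sum (λ e → if does (j ≟ e) then g e * d else 0#)
      ≈⟨ +-congˡ (sum-single j (λ e → g e * d)) ⟩
    ∂ s t g v + g j * d ∎
    where
    term : ∀ e → g e * ι (s′ e) (t′ e) v ≈ g e * ι (s e) (t e) v + (if does (j ≟ e) then g e * d else 0#)
    term e with j ≟ e
    ... | yes ≡.refl = trans (*-congˡ moved) (distribˡ _ _ _)
    ... | no j≢e with same e (j≢e ∘ ≡.sym)
    ... | s≡ , t≡ rewrite s≡ | t≡ = sym (+-identityʳ _)

  ι-trans : ∀ {n} (a b c v : Fin n) → ι a b v + ι b c v ≈ ι a c v
  ι-trans a b c v = begin
    (x - y) + (y - z)     ≈⟨ +-assoc x (- y) (y - z) ⟩
    x + (- y + (y - z))   ≈⟨ +-congˡ (+-assoc (- y) y (- z)) ⟨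
    x + ((- y + y) - z)   ≈⟨ +-congˡ (+-congʳ (-‿inverseˡ y)) ⟩
    x + (0# - z)          ≈⟨ +-congˡ (+-identityˡ (- z)) ⟩
    x - z                 ∎
    where x = δ a v; y = δ b v; z = δ c v

  ∂-reroute-source : ∀ {m n} (s t : Fin m → Fin n) g j a v →
    ∂ (updateAt s j (const a)) t g v ≈ ∂ s t g v + g j * ι a (s j) v
  ∂-reroute-source s t g j a v = ∂-reroute s t _ t g j v _
    (λ e e≢j → updateAt-minimal e j s e≢j , ≡.refl) moved
    where
    moved : ι (updateAt s j (const a) j) (t j) v ≈ ι (s j) (t j) v + ι a (s j) v
    moved rewrite updateAt-updates j {const a} s =
      trans (sym (ι-trans a (s j) (t j) v)) (+-comm _ _)

  ∂-reroute-target : ∀ {m n} (s t : Fin m → Fin n) g j a v →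
    ∂ s (updateAt t j (const a)) g v ≈ ∂ s t g v + g j * ι (t j) a v
  ∂-reroute-target s t g j a v = ∂-reroute s t s _ g j v _
    (λ e e≢j → ≡.refl , updateAt-minimal e j t e≢j) moved
    where
    moved : ι (s j) (updateAt t j (const a) j) v ≈ ι (s j) (t j) v + ι (t j) a v
    moved rewrite updateAt-updates j {const a} t = sym (ι-trans (s j) (t j) a v)

open ≡ using (refl; sym; trans; cong; cong₂; subst)

∧-true : ∀ x y → x ∧ y ≡ true → x ≡ true × y ≡ true
∧-true true true _ = refl , refl

-- Finite verification over F₂

BoolFun : ℕ → Set
BoolFun zero    = Bool
BoolFun (suc k) = Bool → BoolFun k

Valid : ∀ k → BoolFun k → Set
Valid zero    b = b ≡ true
Valid (suc k) f = ∀ x → Valid k (f x)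

valid? : ∀ k → BoolFun k → Bool
valid? zero    b = b
valid? (suc k) f = valid? k (f false) ∧ valid? k (f true)

-- Induction on the leading argument. For a closed formula the hypothesis holds by `refl`, so
-- evaluating all rows becomes a proof.
truth-table : ∀ k f → valid? k f ≡ true → Valid k f
truth-table zero    f ok       = ok
truth-table (suc k) f ok false = truth-table k (f false) (proj₁ (∧-true _ _ ok))
truth-table (suc k) f ok true  = truth-table k (f true) (proj₂ (∧-true _ _ ok))

infixr 3 _⇒_
_⇒_ : Bool → Bool → Bool
false ⇒ _ = true
true  ⇒ y = y

infixl 4 _⟨⇒⟩_
_⟨⇒⟩_ : ∀ {x y} → (x ⇒ y) ≡ true → x ≡ true → y ≡ true
_⟨⇒⟩_ {true} imp _ = imp

same : Bool → Bool → Bool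
same x y = not (x xor y)

same⇒≡ : ∀ x y → same x y ≡ true → x ≡ y
same⇒≡ false false _ = refl
same⇒≡ true  true  _ = refl

search : ∀ k → BoolFun k → Bool
search zero    b = b
search (suc k) f = search k (f false) ∨ search k (f true)

Found : ∀ k → BoolFun k → Set
Found zero    b = b ≡ true
Found (suc k) f = ∃[ x ] Found k (f x)

-- Lets an existence claim stand as a Boolean inside a tabulated formula and still hands out the
-- witness afterwards.
search-sound : ∀ k f → search k f ≡ true → Found k f
search-sound zero    f ok = ok
search-sound (suc k) f ok with search k (f false) in found
... | true  = false , search-sound k (f false) found
... | false = true , search-sound k (f true) ok

V4 : Set
V4 = Bool × Bool

0V : V4
0V = false , false

infixl 6 _⊕_
infixr 7 _·_
_⊕_ : V4 → V4 → V4
(p , q) ⊕ (r , s) = p xor r , q xor s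

_·_ : Bool → V4 → V4
x · (p , q) = x ∧ p , x ∧ q

nz : V4 → Bool
nz (p , q) = p ∨ q

-- Linear in the first argument, and for c ≠ 0 the kernel of ω _ c is {0, c}: adding c where ω _ c = 1 creates no zero.
ω : V4 → V4 → Bool
ω (p , q) (r , s) = (s ∧ p) xor (r ∧ q)

-- For nonzero `a` this picks a vector outside {0, `a`}, that is, outside the kernel of `ω a`.
partner : V4 → V4
partner (p , _) = not p , p

constant distinct : V4 → V4 → V4 → Bool
constant a₁ a₂ a₃ = not (nz (a₁ ⊕ a₂)) ∧ not (nz (a₂ ⊕ a₃)) ∧ not (nz (a₃ ⊕ a₁))
distinct b₁ b₂ b₃ = nz (b₁ ⊕ b₂) ∧ nz (b₂ ⊕ b₃) ∧ nz (b₃ ⊕ b₁)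

linear : (α β γ δ : Bool) → V4 → V4
linear α β γ δ (p , q) = (α ∧ p) xor (β ∧ q) , (γ ∧ p) xor (δ ∧ q)

det : (α β γ δ : Bool) → Bool
det α β γ δ = (α ∧ δ) xor (β ∧ γ)

avoids : (α β γ δ : Bool) (a₁ a₂ a₃ b₁ b₂ b₃ : V4) → Bool
avoids α β γ δ a₁ a₂ a₃ b₁ b₂ b₃ =
  det α β γ δ ∧ nz (a₁ ⊕ linear α β γ δ b₁) ∧ nz (a₂ ⊕ linear α β γ δ b₂) ∧ nz (a₃ ⊕ linear α β γ δ b₃)

compatible : (a₁ a₂ a₃ b₁ b₂ b₃ : V4) → Bool
compatible a₁ a₂ a₃ b₁ b₂ b₃ = search 4 λ α β γ δ → avoids α β γ δ a₁ a₂ a₃ b₁ b₂ b₃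

linear-nz : ∀ α β γ δ b → (det α β γ δ ⇒ nz b ⇒ nz (linear α β γ δ b)) ≡ true
linear-nz α β γ δ (p , q) = truth-table 6
  (λ α β γ δ p q → det α β γ δ ⇒ nz (p , q) ⇒ nz (linear α β γ δ (p , q))) refl α β γ δ p q

rotate-∧ : ∀ x y z → x ∧ y ∧ z ≡ true → y ∧ z ∧ x ≡ true
rotate-∧ true true true _ = refl

-- GL₂(F₂) permutes the three nonzero vectors arbitrarily, and the condition at one edge excludes
-- the two permutations taking `bᵢ` to `aᵢ`. Three conditions exclude all six only if these pairs
-- are disjoint, that is, if any two edges agree in exactly one of the two flows. Then one flow is
-- constant and the other injective.
compatible-or-degenerate : ∀ a₁ a₂ a₃ b₁ b₂ b₃ →
  (nz a₁ ⇒ nz a₂ ⇒ nz a₃ ⇒ nz b₁ ⇒ nz b₂ ⇒ nz b₃ ⇒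
   compatible a₁ a₂ a₃ b₁ b₂ b₃ ∨ (constant a₁ a₂ a₃ ∧ distinct b₁ b₂ b₃) ∨ (constant b₁ b₂ b₃ ∧ distinct a₁ a₂ a₃)) ≡ true
compatible-or-degenerate (p₁ , q₁) (p₂ , q₂) (p₃ , q₃) (r₁ , s₁) (r₂ , s₂) (r₃ , s₃) = truth-table 12
  (λ p₁ q₁ p₂ q₂ p₃ q₃ r₁ s₁ r₂ s₂ r₃ s₃ →
    let a₁ = p₁ , q₁; a₂ = p₂ , q₂; a₃ = p₃ , q₃; b₁ = r₁ , s₁; b₂ = r₂ , s₂; b₃ = r₃ , s₃ in
    nz a₁ ⇒ nz a₂ ⇒ nz a₃ ⇒ nz b₁ ⇒ nz b₂ ⇒ nz b₃ ⇒
    compatible a₁ a₂ a₃ b₁ b₂ b₃ ∨ (constant a₁ a₂ a₃ ∧ distinct b₁ b₂ b₃) ∨ (constant b₁ b₂ b₃ ∧ distinct a₁ a₂ a₃))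
  refl p₁ q₁ p₂ q₂ p₃ q₃ r₁ s₁ r₂ s₂ r₃ s₃

nz-⊕ : ∀ a b → not (nz (a ⊕ b)) ≡ true → a ≡ b
nz-⊕ (false , false) (false , false) _ = refl
nz-⊕ (false , true)  (false , true)  _ = refl
nz-⊕ (true , false)  (true , false)  _ = refl
nz-⊕ (true , true)   (true , true)   _ = refl

distinct⇒≢ : ∀ {A : Set} (f : A → V4) x₁ x₂ x₃ → distinct (f x₁) (f x₂) (f x₃) ≡ true →
             x₁ ≢ x₂ × x₂ ≢ x₃ × x₃ ≢ x₁
distinct⇒≢ f x₁ x₂ x₃ eq with ∧-true (nz (f x₁ ⊕ f x₂)) _ eq
... | 1≠2 , rest with ∧-true (nz (f x₂ ⊕ f x₃)) _ rest
...   | 2≠3 , 3≠1 = differ 1≠2 , differ 2≠3 , differ 3≠1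
  where
  differ : ∀ {x y} → nz (f x ⊕ f y) ≡ true → x ≢ y
  differ {x} eq refl = nz-self (f x) eq
    where
    nz-self : ∀ b → nz (b ⊕ b) ≢ true
    nz-self (false , false) ()
    nz-self (false , true)  ()
    nz-self (true  , false) ()
    nz-self (true  , true)  ()

ω-distinct : ∀ b₁ b₂ b₃ → (nz b₁ ⇒ nz b₂ ⇒ nz b₃ ⇒ distinct b₁ b₂ b₃ ⇒ ω b₁ b₂ ∧ not (ω b₂ b₂) ∧ ω b₃ b₂) ≡ true
ω-distinct (r₁ , s₁) (r₂ , s₂) (r₃ , s₃) = truth-table 6
  (λ r₁ s₁ r₂ s₂ r₃ s₃ → let b₁ = r₁ , s₁; b₂ = r₂ , s₂; b₃ = r₃ , s₃ in
    nz b₁ ⇒ nz b₂ ⇒ nz b₃ ⇒ distinct b₁ b₂ b₃ ⇒ ω b₁ b₂ ∧ not (ω b₂ b₂) ∧ ω b₃ b₂)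
  refl r₁ s₁ r₂ s₂ r₃ s₃

ω-partner : ∀ a → nz a ≡ true → ω a (partner a) ≡ true
ω-partner (false , true)  _ = refl
ω-partner (true  , false) _ = refl
ω-partner (true  , true)  _ = refl

shift-nz : ∀ x v c → (nz v ⇒ (x ⇒ ω v c) ⇒ nz (v ⊕ x · c)) ≡ true
shift-nz x (p , q) (r , s) = truth-table 5
  (λ x p q r s → nz (p , q) ⇒ (x ⇒ ω (p , q) (r , s)) ⇒ nz ((p , q) ⊕ x · (r , s))) refl x p q r s

constant-rotate : ∀ a₁ a₂ a₃ → constant a₁ a₂ a₃ ≡ true → constant a₂ a₃ a₁ ≡ true
constant-rotate a₁ a₂ a₃ = rotate-∧ (not (nz (a₁ ⊕ a₂))) (not (nz (a₂ ⊕ a₃))) (not (nz (a₃ ⊕ a₁)))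

distinct-rotate : ∀ b₁ b₂ b₃ → distinct b₁ b₂ b₃ ≡ true → distinct b₂ b₃ b₁ ≡ true
distinct-rotate b₁ b₂ b₃ = rotate-∧ (nz (b₁ ⊕ b₂)) (nz (b₂ ⊕ b₃)) (nz (b₃ ⊕ b₁))

constant⇒≡ : ∀ a₁ a₂ a₃ → constant a₁ a₂ a₃ ≡ true → a₂ ≡ a₁ × a₃ ≡ a₁
constant⇒≡ a₁ a₂ a₃ eq with ∧-true (not (nz (a₁ ⊕ a₂))) _ eq
... | 1=2 , rest with ∧-true (not (nz (a₂ ⊕ a₃))) _ rest
...   | _ , 3=1 = sym (nz-⊕ a₁ a₂ 1=2) , nz-⊕ a₃ a₁ 3=1

-- If `x₂` holds, the second value is zero and `a` survives there under every matrix. Otherwise b₁ +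
-- b₂ = b₃ makes the first and third values equal. Either way at most two conditions remain,
-- excluding at most four of the six matrices.
path-table : ∀ a b₁ b₂ b₃ x₁ x₂ x₃ →
  (nz a ⇒ nz b₁ ⇒ nz b₂ ⇒ nz b₃ ⇒ distinct b₁ b₂ b₃ ⇒ x₂ ∨ (x₁ xor x₃) ⇒
   compatible a a a (b₁ ⊕ x₁ · b₂) (b₂ ⊕ x₂ · b₂) (b₃ ⊕ x₃ · b₂)) ≡ true
path-table (p , q) (r₁ , s₁) (r₂ , s₂) (r₃ , s₃) x₁ x₂ x₃ = truth-table 11
  (λ p q r₁ s₁ r₂ s₂ r₃ s₃ x₁ x₂ x₃ →
    let a = p , q; b₁ = r₁ , s₁; b₂ = r₂ , s₂; b₃ = r₃ , s₃ in
    nz a ⇒ nz b₁ ⇒ nz b₂ ⇒ nz b₃ ⇒ distinct b₁ b₂ b₃ ⇒ x₂ ∨ (x₁ xor x₃) ⇒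
    compatible a a a (b₁ ⊕ x₁ · b₂) (b₂ ⊕ x₂ · b₂) (b₃ ⊕ x₃ · b₂))
  refl p q r₁ s₁ r₂ s₂ r₃ s₃ x₁ x₂ x₃

-- The first flow now takes exactly the two values `a` and `a ⊕ partner a`, both nonzero, so it is
-- neither constant nor injective, and both degenerate alternatives fail.
star-table : ∀ a b₁ b₂ b₃ x₁ x₂ x₃ →
  (nz a ⇒ nz b₁ ⇒ nz b₂ ⇒ nz b₃ ⇒ distinct b₁ b₂ b₃ ⇒ x₁ ⇒ not (x₂ ∧ x₃) ⇒
   compatible (a ⊕ x₁ · partner a) (a ⊕ x₂ · partner a) (a ⊕ x₃ · partner a) b₁ b₂ b₃) ≡ true
star-table (p , q) (r₁ , s₁) (r₂ , s₂) (r₃ , s₃) x₁ x₂ x₃ = truth-table 11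
  (λ p q r₁ s₁ r₂ s₂ r₃ s₃ x₁ x₂ x₃ →
    let a = p , q; b₁ = r₁ , s₁; b₂ = r₂ , s₂; b₃ = r₃ , s₃ in
    nz a ⇒ nz b₁ ⇒ nz b₂ ⇒ nz b₃ ⇒ distinct b₁ b₂ b₃ ⇒ x₁ ⇒ not (x₂ ∧ x₃) ⇒
    compatible (a ⊕ x₁ · partner a) (a ⊕ x₂ · partner a) (a ⊕ x₃ · partner a) b₁ b₂ b₃)
  refl p q r₁ s₁ r₂ s₂ r₃ s₃ x₁ x₂ x₃

-- Even edge sets and their integer lifts with values 0 and ±1

module Z = Boundary ℤₚ.+-*-commutativeRing
module F = Boundary xor-∧-commutativeRing

Even : ∀ {m n} (s t : Fin m → Fin n) → (Fin m → Bool) → Set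
Even s t p = ∀ v → F.∂ s t p v ≡ false

δ-refl : ∀ {n} (a : Fin n) → F.δ a a ≡ true
δ-refl a rewrite dec-true (a ≟ a) refl = refl

δ-≢ : ∀ {n} {a v : Fin n} → a ≢ v → F.δ a v ≡ false
δ-≢ {a = a} {v} a≢v rewrite dec-false (a ≟ v) a≢v = refl

ι-loop : ∀ {n} (a v : Fin n) → F.ι a a v ≡ false
ι-loop a v = xor-same (F.δ a v)

ι-support : ∀ {n} (a b v : Fin n) → F.ι a b v ≡ true → a ≡ v ⊎ b ≡ v
ι-support a b v eq with a ≟ v | b ≟ v
... | yes a≡v | _       = inj₁ a≡v
... | no _    | yes b≡v = inj₂ b≡v
ι-support a b v () | no _ | no _

sum-true : ∀ {k} (f : Fin k → Bool) → F.sum f ≡ true → ∃[ i ] f i ≡ true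
sum-true {suc k} f eq with f zero in f0
... | true  = zero , f0
... | false with sum-true (f ∘ suc) eq
... | i , fi = suc i , fi

data SignedLift : Bool → ℤ → Set where
  off   : SignedLift false 0ℤ
  plus  : SignedLift true 1ℤ
  minus : SignedLift true -1ℤ

negate : ∀ {b z} → SignedLift b z → SignedLift b (-ℤ z)
negate off   = off
negate plus  = minus
negate minus = plus

xor≡false : ∀ x y → x xor y ≡ false → x ≡ y
xor≡false false false _ = refl
xor≡false true  true  _ = refl


extend : ∀ {m} {p : Fin (suc m) → Bool} {z : ℤ} {h : Fin m → ℤ} →
         SignedLift (p zero) z → (∀ e → SignedLift (p (suc e)) (h e)) →
         ∀ e → SignedLift (p e) ((z ◂ h) e)
extend l ls zero    = l
extend l ls (suc e) = ls e

-- Splitting off: replace the edges a–b, b–c by a single edge a–c and let both inherit its value.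
eulerian-lift : ∀ {m n} (s t : Fin m → Fin n) (p : Fin m → Bool) → Even s t p →
  ∃[ h ] (∀ e → SignedLift (p e) (h e)) × (∀ v → Z.∂ s t h v ≡ 0ℤ)
eulerian-lift {zero} s t p even = (λ ()) , (λ ()) , λ _ → refl
eulerian-lift {suc m} s t p even with p zero in p0
... | false with eulerian-lift (s ∘ suc) (t ∘ suc) (p ∘ suc) even
...   | h , lift , flow = 0ℤ ◂ h , extend (subst (λ b → SignedLift b 0ℤ) (sym p0) off) lift ,
          λ v → trans (cong (_+ℤ Z.∂ (s ∘ suc) (t ∘ suc) h v) (ℤₚ.*-zeroˡ (Z.ι (s zero) (t zero) v)))
                  (trans (ℤₚ.+-identityˡ (Z.∂ (s ∘ suc) (t ∘ suc) h v)) (flow v))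
eulerian-lift {suc m} s t p even | true with s zero ≟ t zero
-- Splitting off can create loops; a loop has no boundary and may carry 1.
... | yes loop with eulerian-lift (s ∘ suc) (t ∘ suc) (p ∘ suc)
                     (λ v → trans (sym (cong (_xor F.∂ (s ∘ suc) (t ∘ suc) (p ∘ suc) v)
                                         (trans (cong (λ a → F.ι a (t zero) v) loop) (ι-loop (t zero) v)))) (even v))
...   | h , lift , flow = 1ℤ ◂ h , extend (subst (λ b → SignedLift b 1ℤ) (sym p0) plus) lift , conserved
  where
  conserved : ∀ v → Z.∂ s t (1ℤ ◂ h) v ≡ 0ℤ
  conserved v = trans (cong₂ _+ℤ_ (trans (ℤₚ.*-identityˡ (Z.ι (s zero) (t zero) v))
                        (trans (cong (λ a → Z.ι a (t zero) v) loop) (ℤₚ.+-inverseʳ (Z.δ (t zero) v)))) (flow v)) refl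
eulerian-lift {suc m} s t p even | true | no a≢b = split (ι-support _ _ _ (proj₂ (∧-true _ _ j-at-b)))
  where
  a = s zero
  b = t zero
  s₁ = s ∘ suc
  t₁ = t ∘ suc
  p₁ = p ∘ suc

  tail-∂ : ∀ v → F.ι a b v ≡ F.∂ s₁ t₁ p₁ v
  tail-∂ v = xor≡false _ _ (even v)

  -- Edge `zero` contributes one at `b`, so evenness forces a further edge `j` of `p` at `b`, not a
  -- loop.
  b-odd : F.∂ s₁ t₁ p₁ b ≡ true
  b-odd = trans (sym (tail-∂ b)) (cong₂ _xor_ (δ-≢ a≢b) (δ-refl b))

  at-b : ∃[ j ] p₁ j ∧ F.ι (s₁ j) (t₁ j) b ≡ true
  at-b = sum-true (λ e → p₁ e ∧ F.ι (s₁ e) (t₁ e) b) b-odd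

  j : Fin m
  j = proj₁ at-b

  j-at-b : p₁ j ∧ F.ι (s₁ j) (t₁ j) b ≡ true
  j-at-b = proj₂ at-b

  j∈p : p₁ j ≡ true
  j∈p = proj₁ (∧-true _ _ j-at-b)

  split : s₁ j ≡ b ⊎ t₁ j ≡ b →
          ∃[ h ] (∀ e → SignedLift (p e) (h e)) × (∀ v → Z.∂ s t h v ≡ 0ℤ)
  split (inj₁ sj≡b) with eulerian-lift (updateAt s₁ j (const a)) t₁ p₁ even′
    where
    even′ : Even (updateAt s₁ j (const a)) t₁ p₁
    even′ v rewrite F.∂-reroute-source s₁ t₁ p₁ j a v | j∈p | sj≡b | tail-∂ v = xor-same (F.∂ s₁ t₁ p₁ v)
  -- The merged edge runs from `a` to the target of `j`. It is replaced by a walk through `b` that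
  -- follows both edges forwards.
  ... | h , lift , flow = h j ◂ h ,
          extend (subst (λ c → SignedLift c (h j)) (trans j∈p (sym p0)) (lift j)) lift , conserved
    where
    conserved : ∀ v → Z.∂ s t (h j ◂ h) v ≡ 0ℤ
    conserved v = trans (ℤₚ.+-comm (h j *ℤ Z.ι a b v) _)
      (trans (cong (λ c → Z.∂ s₁ t₁ h v +ℤ h j *ℤ Z.ι a c v) (sym sj≡b))
        (trans (sym (Z.∂-reroute-source s₁ t₁ h j a v)) (flow v)))
  split (inj₂ tj≡b) with eulerian-lift s₁ (updateAt t₁ j (const a)) p₁ even′
    where
    even′ : Even s₁ (updateAt t₁ j (const a)) p₁
    even′ v rewrite F.∂-reroute-target s₁ t₁ p₁ j a v | j∈p | tj≡b | sym (tail-∂ v) =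
      trans (cong (F.ι a b v xor_) (xor-comm (F.δ b v) (F.δ a v))) (xor-same (F.ι a b v))
  -- Here `j` enters `b`, so the walk continues from `b` to `a` against edge `zero`; hence the sign.
  ... | h , lift , flow = (-ℤ h j) ◂ h ,
          extend (subst (λ c → SignedLift c (-ℤ h j)) (trans j∈p (sym p0)) (negate (lift j))) lift , conserved
    where
    flip-ι : ∀ v → (-ℤ h j) *ℤ Z.ι a b v ≡ h j *ℤ Z.ι b a v
    flip-ι v = trans (sym (ℤₚ.neg-distribˡ-* (h j) (Z.ι a b v)))
      (trans (ℤₚ.neg-distribʳ-* (h j) (Z.ι a b v))
        (cong (h j *ℤ_) (trans (ℤₚ.neg-distrib-+ (Z.δ a v) (-ℤ Z.δ b v))
          (trans (cong (-ℤ Z.δ a v +ℤ_) (ℤₚ.neg-involutive (Z.δ b v))) (ℤₚ.+-comm (-ℤ Z.δ a v) (Z.δ b v))))))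
    conserved : ∀ v → Z.∂ s t ((-ℤ h j) ◂ h) v ≡ 0ℤ
    conserved v = trans (cong (_+ℤ Z.∂ s₁ t₁ h v) (flip-ι v))
      (trans (ℤₚ.+-comm (h j *ℤ Z.ι b a v) _)
        (trans (cong (λ c → Z.∂ s₁ t₁ h v +ℤ h j *ℤ Z.ι c a v) (sym tj≡b))
          (trans (sym (Z.∂-reroute-target s₁ t₁ h j a v)) (flow v))))

-- Integer flows and pairs of even sets

odd : ℕ → Bool
odd zero    = false
odd (suc n) = not (odd n)

parity : ℤ → Bool
parity z = odd ∥ z ∥

odd-+ : ∀ m n → odd (m +ℕ n) ≡ odd m xor odd n
odd-+ zero    n = refl
odd-+ (suc m) n = trans (cong not (odd-+ m n)) (not-distribˡ-xor (odd m) (odd n))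

parity-⊖ : ∀ m n → parity (m ⊖ n) ≡ odd m xor odd n
parity-⊖ zero    zero    = refl
parity-⊖ zero    (suc n) = refl
parity-⊖ (suc m) zero    = sym (xor-identityʳ _)
parity-⊖ (suc m) (suc n) = trans (cong parity (ℤₚ.[1+m]⊖[1+n]≡m⊖n m n))
  (trans (parity-⊖ m n) (sym (xor-annihilates-not (odd m) (odd n))))

parity-+ : ∀ x y → parity (x +ℤ y) ≡ parity x xor parity y
parity-+ (+ m)    (+ n)    = odd-+ m n
parity-+ (+ m)    -[1+ n ] = parity-⊖ m (suc n)
parity-+ -[1+ m ] (+ n)    = trans (parity-⊖ n (suc m)) (xor-comm (odd n) _)
parity-+ -[1+ m ] -[1+ n ] = trans (cong (not ∘ not) (odd-+ m n)) (trans (cong not (not-distribʳ-xor (odd m) (odd n)))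
  (not-distribˡ-xor (odd m) (not (odd n))))

parity-neg : ∀ x → parity (-ℤ x) ≡ parity x
parity-neg x = cong odd (ℤₚ.∣-i∣≡∣i∣ x)

parity-term : ∀ {n} x (a b v : Fin n) → parity (x *ℤ Z.ι a b v) ≡ parity x ∧ F.ι a b v
parity-term x a b v with does (a ≟ v) | does (b ≟ v)
... | false | false = trans (cong parity (ℤₚ.*-zeroʳ x)) (sym (∧-zeroʳ _))
... | true  | true  = trans (cong parity (ℤₚ.*-zeroʳ x)) (sym (∧-zeroʳ _))
... | true  | false = trans (cong parity (ℤₚ.*-identityʳ x)) (sym (∧-identityʳ _))
... | false | true  = trans (cong parity (trans (ℤₚ.*-comm x -1ℤ) (ℤₚ.-1*i≡-i x)))
                            (trans (parity-neg x) (sym (∧-identityʳ _)))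

parity-sum : ∀ {k} (f : Fin k → ℤ) → parity (Z.sum f) ≡ F.sum (parity ∘ f)
parity-sum {zero}  f = refl
parity-sum {suc k} f = trans (parity-+ (f zero) _) (cong (parity (f zero) xor_) (parity-sum (f ∘ suc)))

parity-∂ : ∀ {m n} (s t : Fin m → Fin n) g v → parity (Z.∂ s t g v) ≡ F.∂ s t (parity ∘ g) v
parity-∂ s t g v = trans (parity-sum (λ e → g e *ℤ Z.ι (s e) (t e) v))
                         (F.sum-cong-≗ (λ e → parity-term (g e) (s e) (t e) v))

half-ℕ : ∀ n → odd n ≡ false → ∃[ k ] n ≡ k +ℕ k
half-ℕ zero          _    = zero , refl
half-ℕ (suc (suc n)) even with odd n in n-odd
... | false with half-ℕ n n-odd
...   | k , refl = suc k , cong suc (sym (+-suc k k))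

half : ∀ z → parity z ≡ false → ∃[ k ] z ≡ k +ℤ k
half (+ n) even with half-ℕ n even
... | k , refl = + k , refl
half -[1+ n ] even with half-ℕ (suc n) even
... | suc k , eq = -[1+ k ] , cong (-ℤ_ ∘ +_) (trans eq (cong suc (+-suc k k)))

double≡0 : ∀ x → x +ℤ x ≡ 0ℤ → x ≡ 0ℤ
double≡0 (+ zero) _ = refl

double-small : ∀ x → 0 < ∥ x +ℤ x ∥ → ∥ x +ℤ x ∥ < 4 → parity x ≡ true
double-small (+ suc zero) _ _ = refl
double-small (+ suc (suc n)) _ lt rewrite +-suc n (suc n) | +-suc n n with lt
... | s≤s (s≤s (s≤s (s≤s ())))
double-small -[1+ zero ] _ _ = refl
double-small -[1+ suc n ] _ lt rewrite +-suc n n with lt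
... | s≤s (s≤s (s≤s (s≤s ())))

parity-lift : ∀ {b z} → SignedLift b z → parity z ≡ b
parity-lift off   = refl
parity-lift plus  = refl
parity-lift minus = refl

lift-false : ∀ {b z} → b ≡ false → SignedLift b z → z ≡ 0ℤ
lift-false _ off = refl

even-pair-of-flow : ∀ {m n} (s t : Fin m → Fin n) (g : Fin m → ℤ) → (∀ v → Z.∂ s t g v ≡ 0ℤ) →
  ∃[ p ] ∃[ q ] Even s t p × Even s t q ×
    (∀ e → g e ≡ 0ℤ → p e ≡ false × q e ≡ false) ×
    (∀ e → 0 < ∥ g e ∥ → ∥ g e ∥ < 4 → p e ∨ q e ≡ true)
even-pair-of-flow {m} s t g flow = p , parity ∘ k , p-even , k-even , vanish , nowhere-zero
  where
  p : Fin m → Bool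
  p = parity ∘ g

  p-even : Even s t p
  p-even v = trans (sym (parity-∂ s t g v)) (cong parity (flow v))

  lifted = eulerian-lift s t p p-even
  h = proj₁ lifted
  lift = proj₁ (proj₂ lifted)

  halves : ∀ e → ∃[ k ] g e -ℤ h e ≡ k +ℤ k
  halves e = half (g e -ℤ h e) (trans (parity-+ (g e) (-ℤ h e))
    (trans (cong (p e xor_) (trans (parity-neg (h e)) (parity-lift (lift e)))) (xor-same (p e))))

  k : Fin m → ℤ
  k e = proj₁ (halves e)

  split : ∀ e → g e ≡ h e +ℤ (k e +ℤ k e)
  split e = trans (sym (trans (cong (h e +ℤ_) (ℤₚ.+-comm (g e) (-ℤ h e)))
                  (trans (sym (ℤₚ.+-assoc (h e) (-ℤ h e) (g e)))
                  (trans (cong (_+ℤ g e) (ℤₚ.+-inverseʳ (h e))) (ℤₚ.+-identityˡ (g e))))))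
                  (cong (h e +ℤ_) (proj₂ (halves e)))

  ∂-split : ∀ v → Z.∂ s t g v ≡ Z.∂ s t h v +ℤ (Z.∂ s t k v +ℤ Z.∂ s t k v)
  ∂-split v = trans (Z.sum-cong-≗ (λ e → cong (_*ℤ Z.ι (s e) (t e) v) (split e)))
    (trans (Z.∂-+ s t h (λ e → k e +ℤ k e) v) (cong (Z.∂ s t h v +ℤ_) (Z.∂-+ s t k k v)))

  -- Since `g` and `h` are flows, twice the boundary of `k` vanishes, and ℤ has no 2-torsion.
  k-flow : ∀ v → Z.∂ s t k v ≡ 0ℤ
  k-flow v = double≡0 (Z.∂ s t k v) (trans (sym (ℤₚ.+-identityˡ _))
    (trans (cong (_+ℤ (Z.∂ s t k v +ℤ Z.∂ s t k v)) (sym (proj₂ (proj₂ lifted) v)))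
    (trans (sym (∂-split v)) (flow v))))

  k-even : Even s t (parity ∘ k)
  k-even v = trans (sym (parity-∂ s t k v)) (cong parity (k-flow v))

  even-value : ∀ e → p e ≡ false → g e ≡ k e +ℤ k e
  even-value e pe = trans (split e) (trans (cong (_+ℤ (k e +ℤ k e)) (lift-false pe (lift e))) (ℤₚ.+-identityˡ _))

  vanish : ∀ e → g e ≡ 0ℤ → p e ≡ false × parity (k e) ≡ false
  vanish e ge≡0 = pe , cong parity (double≡0 (k e) (trans (sym (even-value e pe)) ge≡0))
    where
    pe : p e ≡ false
    pe = cong parity ge≡0

  -- Where `g e` is even it equals 2 `k e` with absolute value below 4, so `k e` is ±1.
  nowhere-zero : ∀ e → 0 < ∥ g e ∥ → ∥ g e ∥ < 4 → p e ∨ parity (k e) ≡ true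
  nowhere-zero e 0< <4 = go (p e) refl
    where
    go : ∀ b → p e ≡ b → b ∨ parity (k e) ≡ true
    go true  _  = refl
    go false pe = double-small (k e) (subst (λ z → 0 < ∥ z ∥) (even-value e pe) 0<)
                                     (subst (λ z → ∥ z ∥ < 4) (even-value e pe) <4)

-- With `h` and `k` in {0, ±1}, the value h + 2k has absolute value at most 3 and is zero only if
-- both are.
flow-of-even-pair : ∀ {m n} (s t : Fin m → Fin n) (p q : Fin m → Bool) →
  Even s t p → Even s t q → (∀ e → p e ∨ q e ≡ true) →
  ∃[ g ] (∀ v → Z.∂ s t g v ≡ 0ℤ) × (∀ e → 0 < ∥ g e ∥ × ∥ g e ∥ < 4)
flow-of-even-pair {m} s t p q p-even q-even cover
  with eulerian-lift s t p p-even | eulerian-lift s t q q-even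
... | h , h-lift , h-flow | k , k-lift , k-flow = (λ e → h e +ℤ (k e +ℤ k e)) , flow ,
        λ e → bounds (h-lift e) (k-lift e) (cover e)
  where
  flow : ∀ v → Z.∂ s t (λ e → h e +ℤ (k e +ℤ k e)) v ≡ 0ℤ
  flow v = trans (Z.∂-+ s t h (λ e → k e +ℤ k e) v)
    (cong₂ _+ℤ_ (h-flow v) (trans (Z.∂-+ s t k k v) (cong₂ _+ℤ_ (k-flow v) (k-flow v))))

  bounds : ∀ {b c x y} → SignedLift b x → SignedLift c y → b ∨ c ≡ true →
           0 < ∥ x +ℤ (y +ℤ y) ∥ × ∥ x +ℤ (y +ℤ y) ∥ < 4
  bounds off   plus  _ = s≤s z≤n , s≤s (s≤s (s≤s z≤n))
  bounds off   minus _ = s≤s z≤n , s≤s (s≤s (s≤s z≤n))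
  bounds plus  off   _ = s≤s z≤n , s≤s (s≤s z≤n)
  bounds plus  plus  _ = s≤s z≤n , s≤s (s≤s (s≤s (s≤s z≤n)))
  bounds plus  minus _ = s≤s z≤n , s≤s (s≤s z≤n)
  bounds minus off   _ = s≤s z≤n , s≤s (s≤s z≤n)
  bounds minus plus  _ = s≤s z≤n , s≤s (s≤s z≤n)
  bounds minus minus _ = s≤s z≤n , s≤s (s≤s (s≤s (s≤s z≤n)))

-- Passing between nowhere-zero 4-flows and V₄-flows

source target : (Γ : Graph) → Fin (m Γ) → Fin (n Γ)
source Γ e = proj₁ (ends Γ e)
target Γ e = proj₂ (ends Γ e)

Σℤ≡sum : ∀ {k} (f : Fin k → ℤ) → Σℤ f ≡ Z.sum f
Σℤ≡sum {zero}  f = refl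
Σℤ≡sum {suc k} f = cong (f zero +ℤ_) (Σℤ≡sum (f ∘ suc))

indicator : Bool → ℤ
indicator b = if b then 1ℤ else 0ℤ

forward-balance : ∀ x a b → (if a then x else 0ℤ) ≡ x *ℤ (indicator a -ℤ indicator b) +ℤ (if b then x else 0ℤ)
forward-balance x false false = sym (trans (ℤₚ.+-identityʳ _) (ℤₚ.*-zeroʳ x))
forward-balance x true  false = sym (trans (ℤₚ.+-identityʳ _) (ℤₚ.*-identityʳ x))
forward-balance x true  true  = sym (trans (cong (_+ℤ x) (ℤₚ.*-zeroʳ x)) (ℤₚ.+-identityˡ x))
forward-balance x false true  = sym (trans (cong (_+ℤ x) (trans (ℤₚ.*-comm x -1ℤ) (ℤₚ.-1*i≡-i x))) (ℤₚ.+-inverseˡ x))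

backward-balance : ∀ x a b → (if b then x else 0ℤ) ≡ (-ℤ x) *ℤ (indicator a -ℤ indicator b) +ℤ (if a then x else 0ℤ)
backward-balance x false false = sym (trans (ℤₚ.+-identityʳ _) (ℤₚ.*-zeroʳ (-ℤ x)))
backward-balance x true  false = sym (trans (cong (_+ℤ x) (ℤₚ.*-identityʳ (-ℤ x))) (ℤₚ.+-inverseˡ x))
backward-balance x true  true  = sym (trans (cong (_+ℤ x) (ℤₚ.*-zeroʳ (-ℤ x))) (ℤₚ.+-identityˡ x))
backward-balance x false true  = sym (trans (ℤₚ.+-identityʳ _)
  (trans (ℤₚ.*-comm (-ℤ x) -1ℤ) (trans (ℤₚ.-1*i≡-i (-ℤ x)) (ℤₚ.neg-involutive x))))

module _ (Γ : Graph) (E : Subset (m Γ)) (D : Orientation Γ) (φ : Fin (m Γ) → ℤ) where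

  -- Trades the orientation for a sign relative to the stored ends and extends by zero, so that
  -- conservation on a subgraph becomes a vanishing boundary over all edges.
  signed : Fin (m Γ) → ℤ
  signed e = if memb E e then (if D e then φ e else -ℤ φ e) else 0ℤ

  outSum≡∂+inSum : ∀ v → outSum Γ E D φ v ≡ Z.∂ (source Γ) (target Γ) signed v +ℤ inSum Γ E D φ v
  outSum≡∂+inSum v = trans (Σℤ≡sum out) (trans (Z.sum-cong-≗ term)
      (trans (Z.∑-distrib-+ net inn) (cong (Z.sum net +ℤ_) (sym (Σℤ≡sum inn)))))
    where
    out inn net : Fin (m Γ) → ℤ
    out e = if memb E e then (if does (tail Γ D e ≟ v) then φ e else 0ℤ) else 0ℤ
    inn e = if memb E e then (if does (head Γ D e ≟ v) then φ e else 0ℤ) else 0ℤ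
    net e = signed e *ℤ Z.ι (source Γ e) (target Γ e) v

    term : ∀ e → out e ≡ net e +ℤ inn e
    term e with memb E e | D e
    ... | false | _     = sym (trans (ℤₚ.+-identityʳ _) (ℤₚ.*-zeroˡ (Z.ι (source Γ e) (target Γ e) v)))
    ... | true  | true  = forward-balance (φ e) (does (source Γ e ≟ v)) (does (target Γ e ≟ v))
    ... | true  | false = backward-balance (φ e) (does (source Γ e ≟ v)) (does (target Γ e ≟ v))

Cycle : ∀ {m n} (s t : Fin m → Fin n) → (Fin m → V4) → Set
Cycle s t φ = Even s t (proj₁ ∘ φ) × Even s t (proj₂ ∘ φ)

-- Flows on a subgraph are extended by zero to all edges, so that flows of the two parts can be
-- added.
record NowhereZero {m n} (s t : Fin m → Fin n) (E : Subset m) (φ : Fin m → V4) : Set where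
  field
    cycle     : Cycle s t φ
    vanish    : ∀ e → e ∉ E → φ e ≡ 0V
    nowhere-0 : ∀ e → e ∈ E → nz (φ e) ≡ true

V4Flow : (Γ : Graph) → Subset (m Γ) → Set
V4Flow Γ E = ∃[ φ ] NowhereZero (source Γ) (target Γ) E φ

to-V4Flow : (Γ : Graph) (H : Subgraph Γ) → NZ4Flow Γ H → V4Flow Γ (E H)
to-V4Flow Γ H f = assemble (even-pair-of-flow (source Γ) (target Γ) g flow)
  where
  open NZ4Flow f
  g = signed Γ (E H) D φ

  -- Conservation is given only at vertices of `H`; at any other vertex `closed` leaves no edge of
  -- `H`, and each term vanishes.
  isolated : ∀ v → ¬ v ∈ V H → ∀ e → g e *ℤ Z.ι (source Γ e) (target Γ e) v ≡ 0ℤ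
  isolated v v∉V e with memb (E H) e in e∈E
  ... | false = ℤₚ.*-zeroˡ (Z.ι (source Γ e) (target Γ e) v)
  ... | true with source Γ e ≟ v | target Γ e ≟ v | closed H e (lookup⇒[]= e (E H) e∈E)
  ...   | yes refl | _        | s∈V , _   = contradiction s∈V v∉V
  ...   | no _     | yes refl | _   , t∈V = contradiction t∈V v∉V
  ...   | no _     | no _     | _         = ℤₚ.*-zeroʳ (if D e then φ e else -ℤ φ e)

  flow : ∀ v → Z.∂ (source Γ) (target Γ) g v ≡ 0ℤ
  flow v with v ∈? V H
  ... | yes v∈V = ∙-cancelʳ ℤₚ.+-0-abelianGroup (inSum Γ (E H) D φ v) _ 0ℤ
                    (trans (sym (outSum≡∂+inSum Γ (E H) D φ v))
                    (trans (conserve v v∈V) (sym (ℤₚ.+-identityˡ _))))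
  ... | no v∉V  = trans (Z.sum-cong-≗ (isolated v v∉V)) (Z.sum-replicate-zero (m Γ))

  signed-bounds : ∀ e → e ∈ E H → 0 < ∥ g e ∥ × ∥ g e ∥ < 4
  signed-bounds e e∈E with nowhere0 e e∈E
  ... | bounds rewrite []=⇒lookup e∈E with D e
  ...   | true  = bounds
  ...   | false rewrite ℤₚ.∣-i∣≡∣i∣ (φ e) = bounds

  g-vanish : ∀ e → e ∉ E H → g e ≡ 0ℤ
  g-vanish e e∉E with memb (E H) e in e∈E
  ... | true  = contradiction (lookup⇒[]= e (E H) e∈E) e∉E
  ... | false = refl

  assemble : (∃[ p ] ∃[ q ] Even (source Γ) (target Γ) p × Even (source Γ) (target Γ) q ×
               (∀ e → g e ≡ 0ℤ → p e ≡ false × q e ≡ false) ×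
               (∀ e → 0 < ∥ g e ∥ → ∥ g e ∥ < 4 → p e ∨ q e ≡ true)) →
             V4Flow Γ (E H)
  assemble (p , q , p-even , q-even , vanish , nowhere-0) = (λ e → p e , q e) , record
    { cycle = p-even , q-even
    ; vanish = λ e e∉E → let (pe , qe) = vanish e (g-vanish e e∉E) in cong₂ _,_ pe qe
    ; nowhere-0 = λ e e∈E → nowhere-0 e (proj₁ (signed-bounds e e∈E)) (proj₂ (signed-bounds e e∈E)) }

from-V4Flow : (Γ : Graph) → V4Flow Γ ⊤ → NZ4Flow Γ (whole Γ)
from-V4Flow Γ (φ , f) with flow-of-even-pair (source Γ) (target Γ) (proj₁ ∘ φ) (proj₂ ∘ φ)
                             (proj₁ cycle) (proj₂ cycle) (λ e → nowhere-0 e ∈⊤)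
  where open NowhereZero f
... | g , flow , bounds = record
  -- Every edge keeps its stored direction; the sign of `g` does the work of the orientation.
  { D = const true ; φ = g ; nowhere0 = λ e _ → bounds e
  ; conserve = λ v _ → trans (outSum≡∂+inSum Γ ⊤ (const true) g v)
      (trans (cong (_+ℤ inSum Γ ⊤ (const true) g v)
               (trans (Z.sum-cong-≗ (λ e → cong (λ b → (if b then g e else 0ℤ) *ℤ Z.ι (source Γ e) (target Γ e) v)
                                                (lookup-replicate e true)))
                      (flow v)))
             (ℤₚ.+-identityˡ _)) }

_⊆_ : ∀ {m} → (Fin m → Bool) → (Fin m → Bool) → Set
p ⊆ q = ∀ e → p e ≡ true → q e ≡ true

xor-cases : ∀ x y → x xor y ≡ true → x ≡ true ⊎ y ≡ true
xor-cases true  _ _  = inj₁ refl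
xor-cases false _ eq = inj₂ eq

Touches : ∀ {m n} (s t : Fin m → Fin n) → Fin m → Fin n → Set
Touches s t e v = s e ≡ v ⊎ t e ≡ v

even-xor : ∀ {m n} (s t : Fin m → Fin n) p q → Even s t p → Even s t q →
           Even s t (λ e → p e xor q e)
even-xor s t p q p-even q-even v = trans (F.∂-+ s t p q v) (cong₂ _xor_ (p-even v) (q-even v))

even-scale : ∀ {m n} (s t : Fin m → Fin n) c p → Even s t p → Even s t (λ e → c ∧ p e)
even-scale s t true  p p-even = p-even
even-scale {m} s t false p p-even v = F.sum-replicate-zero m

-- Even edge sets with prescribed behaviour

-- Connectedness in the edge set `B`, encoded by representatives. `path v` is an F₂-chain from `v`
-- to its root rather than a walk; for two vertices with the same root the sum of their chains joins
-- them.
record Components {m n} (s t : Fin m → Fin n) (B : Fin m → Bool) : Set where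
  field
    root    : Fin n → Fin n
    path    : Fin n → Fin m → Bool
    path⊆   : ∀ v → path v ⊆ B
    joined  : ∀ e → B e ≡ true → root (s e) ≡ root (t e)
    path-∂  : ∀ v x → F.∂ s t (path v) x ≡ F.ι v (root v) x

  root-source : ∀ e x → B e ≡ true → Touches s t e x → root (s e) ≡ root x
  root-source e x Be (inj₁ s≡x) = cong root s≡x
  root-source e x Be (inj₂ t≡x) = trans (joined e Be) (cong root t≡x)

relink : ∀ a b c d v → (a xor b) xor ((v xor d) xor ((b xor d) xor (a xor c))) ≡ v xor c
relink a b c d v = same⇒≡ _ _ (truth-table 5
  (λ a b c d v → same ((a xor b) xor ((v xor d) xor ((b xor d) xor (a xor c)))) (v xor c)) refl a b c d v)

-- Induction on the edges. A new edge a-b of `B` moves the class of `b` to the root of `a`: the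
-- chain goes to the old root, back to `b`, across the edge and on to the root of `a`. If `a` and
-- `b` were already joined, the same formula is still valid.
components : ∀ {m n} (s t : Fin m → Fin n) B → Components s t B
components {zero} s t B = record
  { root = λ v → v ; path = λ _ () ; path⊆ = λ _ () ; joined = λ ()
  ; path-∂ = λ v x → sym (ι-loop v x) }
components {suc m} s t B with B zero in B0 | components (s ∘ suc) (t ∘ suc) (B ∘ suc)
... | false | C = record
  { root = root ; path = λ v → false ◂ path v
  ; path⊆ = λ { v (suc e) → path⊆ v e }
  ; joined = λ { zero B0′ → contradiction (trans (sym B0) B0′) λ () ; (suc e) → joined e }
  ; path-∂ = path-∂ }
  where open Components C
... | true | C = record
  { root = λ v → proj₁ (new v) ; path = λ v → proj₁ (proj₂ (new v))
  ; path⊆ = λ v → proj₁ (proj₂ (proj₂ (new v)))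
  ; joined = joined′
  ; path-∂ = λ v → proj₂ (proj₂ (proj₂ (new v))) }
  where
  open Components C
  a = s zero
  b = t zero

  detour : Fin _ → Fin m → Bool
  detour v e = path v e xor (path b e xor path a e)

  detour⊆ : ∀ v → (true ◂ detour v) ⊆ B
  detour⊆ v zero    _  = B0
  detour⊆ v (suc e) eq with xor-cases (path v e) _ eq
  ... | inj₁ in-v = path⊆ v e in-v
  ... | inj₂ in-ba with xor-cases (path b e) _ in-ba
  ...   | inj₁ in-b = path⊆ b e in-b
  ...   | inj₂ in-a = path⊆ a e in-a

  detour-∂ : ∀ v → root v ≡ root b → ∀ x → F.∂ s t (true ◂ detour v) x ≡ F.ι v (root a) x
  detour-∂ v v~b x = trans (cong (F.ι a b x xor_)
      (trans (F.∂-+ (s ∘ suc) (t ∘ suc) (path v) (λ e → path b e xor path a e) x)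
        (cong₂ _xor_ (trans (path-∂ v x) (cong (λ r → F.ι v r x) v~b))
          (trans (F.∂-+ (s ∘ suc) (t ∘ suc) (path b) (path a) x)
            (cong₂ _xor_ (path-∂ b x) (path-∂ a x))))))
    (relink (F.δ a x) (F.δ b x) (F.δ (root a) x) (F.δ (root b) x) (F.δ v x))

  new : ∀ v → ∃[ r ] ∃[ p ] p ⊆ B × (∀ x → F.∂ s t p x ≡ F.ι v r x)
  new v with root v ≟ root b
  ... | yes v~b = root a , true ◂ detour v , detour⊆ v , detour-∂ v v~b
  ... | no  _   = root v , false ◂ path v , (λ { (suc e) → path⊆ v e }) , path-∂ v

  new-root : Fin _ → Fin _
  new-root v = proj₁ (new v)

  joined′ : ∀ e → B e ≡ true → new-root (s e) ≡ new-root (t e)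
  joined′ zero _ with root a ≟ root b | root b ≟ root b
  ... | yes _ | yes _   = refl
  ... | no _  | yes _   = refl
  ... | _     | no b≁b  = contradiction refl b≁b
  joined′ (suc e) Be with root (s (suc e)) ≟ root b | root (t (suc e)) ≟ root b | joined e Be
  ... | yes _   | yes _   | _  = refl
  ... | no _    | no _    | eq = eq
  ... | yes s~b | no t≁b  | eq = contradiction (trans (sym eq) s~b) t≁b
  ... | no s≁b  | yes t~b | eq = contradiction (trans eq t~b) s≁b

∨-cases : ∀ x y → x ∨ y ≡ true → x ≡ true ⊎ y ≡ true
∨-cases true  _ _  = inj₁ refl
∨-cases false _ eq = inj₂ eq

∧-ι-cong : ∀ {n} {x y} (a b v : Fin n) → (F.ι a b v ≡ true → x ≡ y) → x ∧ F.ι a b v ≡ y ∧ F.ι a b v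
∧-ι-cong {x = x} {y} a b v eq with F.ι a b v
... | true  = cong (_∧ true) (eq refl)
... | false = trans (∧-zeroʳ x) (sym (∧-zeroʳ y))

⊆-refute : ∀ {m} {p q : Fin m → Bool} → p ⊆ q → ∀ e → q e ≡ false → p e ≡ false
⊆-refute p⊆q e qe = ¬-not (λ pe → contradiction (trans (sym qe) (p⊆q e pe)) λ ())

module _ {m n} (s t : Fin m → Fin n) where

  ∂-local : ∀ p q x → (∀ e → Touches s t e x → p e ≡ q e) → F.∂ s t p x ≡ F.∂ s t q x
  ∂-local p q x agree = F.sum-cong-≗ λ e →
    ∧-ι-cong (s e) (t e) x (λ at-x → agree e (ι-support (s e) (t e) x at-x))

  ∅-even : Even s t (const false)
  ∅-even _ = F.sum-replicate-zero m

  -- Both ends of an edge of `A` lie in one component, so at each vertex either all edges of `A` are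
  -- kept or none.
  component-even : ∀ A (C : Components s t A) r → Even s t A →
                   Even s t (λ e → A e ∧ does (Components.root C (s e) ≟ r))
  component-even A C r even x = go (root x ≟ r)
    where
    open Components C
    K : Fin m → Bool
    K e = A e ∧ does (root (s e) ≟ r)

    inside : root x ≡ r → ∀ e → Touches s t e x → K e ≡ A e
    inside x~r e at-x with A e in Ae
    ... | false = refl
    ... | true  = dec-true (root (s e) ≟ r) (trans (root-source e x Ae at-x) x~r)

    outside : root x ≢ r → ∀ e → Touches s t e x → K e ≡ false
    outside x≁r e at-x with A e in Ae
    ... | false = refl
    ... | true  = dec-false (root (s e) ≟ r) (λ s~r → x≁r (trans (sym (root-source e x Ae at-x)) s~r))

    go : Dec (root x ≡ r) → F.∂ s t K x ≡ false
    go (yes x~r) = trans (∂-local K A x (inside x~r)) (even x)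
    go (no  x≁r) = trans (∂-local K (const false) x (outside x≁r)) (∅-even x)

  -- Every edge has two ends, so the boundary sums to zero over all vertices; a single odd vertex is
  -- impossible.
  handshake : ∀ p v → (∀ x → x ≢ v → F.∂ s t p x ≡ false) → Even s t p
  handshake p v even-off-v x with x ≟ v
  ... | no  x≢v  = even-off-v x x≢v
  ... | yes refl = trans (sym (F.sum-single v (F.∂ s t p))) (trans (sym (F.sum-cong-≗ concentrated)) total)
    where
    concentrated : ∀ x → F.∂ s t p x ≡ (if does (v ≟ x) then F.∂ s t p x else false)
    concentrated x with v ≟ x
    ... | yes _   = refl
    ... | no  v≢x = even-off-v x (v≢x ∘ sym)

    ends-cancel : ∀ e → F.sum (λ x → p e ∧ F.ι (s e) (t e) x) ≡ false
    ends-cancel e = trans (sym (F.*-distribˡ-sum (p e) (F.ι (s e) (t e))))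
      (trans (cong (p e ∧_) (trans (F.∑-distrib-+ (F.δ (s e)) (F.δ (t e)))
        (cong₂ _xor_ (F.sum-single (s e) (const true)) (F.sum-single (t e) (const true)))))
        (∧-zeroʳ (p e)))

    total : F.sum (F.∂ s t p) ≡ false
    total = trans (F.∑-comm (λ x e → p e ∧ F.ι (s e) (t e) x))
      (trans (F.sum-cong-≗ ends-cancel) (F.sum-replicate-zero m))

  -- Either the ends of e₂ are joined within A, which closes a cycle through e₂,
  -- or a component of A separates e₁ from e₃.
  even-set-near-path : ∀ A e₁ e₂ e₃ → Even s t A →
    A e₁ ≡ true → A e₂ ≡ false → A e₃ ≡ true →
    Touches s t e₁ (s e₂) ⊎ Touches s t e₃ (s e₂) →
    Touches s t e₁ (t e₂) ⊎ Touches s t e₃ (t e₂) →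
    ∃[ X ] Even s t X × (∀ e → e ≢ e₂ → X e ≡ true → A e ≡ true) × X e₂ ∨ (X e₁ xor X e₃) ≡ true
  even-set-near-path A e₁ e₂ e₃ even A₁ A₂ A₃ at-s at-t = go (root (s e₂) ≟ root (t e₂)) at-s at-t
    where
    C = components s t A
    open Components C
    Goal : Set
    Goal = ∃[ X ] Even s t X × (∀ e → e ≢ e₂ → X e ≡ true → A e ≡ true) × X e₂ ∨ (X e₁ xor X e₃) ≡ true

    -- The edge `e₂` with the chains from its ends to their common root.
    closing : Fin m → Bool
    closing e = F.δ e₂ e xor (path (s e₂) e xor path (t e₂) e)

    closing-even : root (s e₂) ≡ root (t e₂) → Even s t closing
    closing-even s~t x = trans (F.∂-+ s t (F.δ e₂) (λ e → path (s e₂) e xor path (t e₂) e) x)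
      (trans (cong₂ _xor_ (F.∂-single s t e₂ x)
        (trans (F.∂-+ s t (path (s e₂)) (path (t e₂)) x)
          (cong₂ _xor_ (trans (path-∂ (s e₂) x) (cong (λ r → F.ι (s e₂) r x) s~t)) (path-∂ (t e₂) x))))
        (same⇒≡ _ _ (truth-table 3 (λ a b c → same ((a xor b) xor ((a xor c) xor (b xor c))) false) refl
          (F.δ (s e₂) x) (F.δ (t e₂) x) (F.δ (root (t e₂)) x))))

    closing⊆ : ∀ e → e ≢ e₂ → closing e ≡ true → A e ≡ true
    closing⊆ e e≢ Xe rewrite δ-≢ {a = e₂} {e} (e≢ ∘ sym) with xor-cases (path (s e₂) e) _ Xe
    ... | inj₁ in-s = path⊆ (s e₂) e in-s
    ... | inj₂ in-t = path⊆ (t e₂) e in-t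

    closing-e₂ : closing e₂ ≡ true
    closing-e₂ = cong₂ _xor_ (δ-refl e₂) (cong₂ _xor_ (⊆-refute (path⊆ (s e₂)) e₂ A₂) (⊆-refute (path⊆ (t e₂)) e₂ A₂))

    separating : ∀ r → does (root (s e₁) ≟ r) xor does (root (s e₃) ≟ r) ≡ true → Goal
    separating r sep = (λ e → A e ∧ does (root (s e) ≟ r)) , component-even A C r even ,
      (λ e _ Ke → proj₁ (∧-true _ _ Ke)) , separates
      where
      separates : (A e₂ ∧ does (root (s e₂) ≟ r)) ∨
                  ((A e₁ ∧ does (root (s e₁) ≟ r)) xor (A e₃ ∧ does (root (s e₃) ≟ r))) ≡ true
      separates rewrite A₁ | A₂ | A₃ = sep

    go : Dec (root (s e₂) ≡ root (t e₂)) →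
         Touches s t e₁ (s e₂) ⊎ Touches s t e₃ (s e₂) → Touches s t e₁ (t e₂) ⊎ Touches s t e₃ (t e₂) → Goal
    go (yes s~t) _ _ = closing , closing-even s~t , closing⊆ , cong (_∨ (closing e₁ xor closing e₃)) closing-e₂
    -- One edge of `A` meeting both ends of `e₂` would join them; so `e₁` and `e₃` sit at different
    -- ends, and the component of the source of `e₂` contains exactly one of them.
    go (no s≁t) (inj₁ 1s) (inj₁ 1t) = contradiction (trans (sym (root-source e₁ _ A₁ 1s)) (root-source e₁ _ A₁ 1t)) s≁t
    go (no s≁t) (inj₂ 3s) (inj₂ 3t) = contradiction (trans (sym (root-source e₃ _ A₃ 3s)) (root-source e₃ _ A₃ 3t)) s≁t
    go (no s≁t) (inj₁ 1s) (inj₂ 3t) = separating (root (s e₂)) (cong₂ _xor_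
      (dec-true (root (s e₁) ≟ root (s e₂)) (root-source e₁ _ A₁ 1s))
      (dec-false (root (s e₃) ≟ root (s e₂)) (λ eq → s≁t (trans (sym eq) (root-source e₃ _ A₃ 3t)))))
    go (no s≁t) (inj₂ 3s) (inj₁ 1t) = separating (root (s e₂)) (cong₂ _xor_
      (dec-false (root (s e₁) ≟ root (s e₂)) (λ eq → s≁t (trans (sym eq) (root-source e₁ _ A₁ 1t))))
      (dec-true (root (s e₃) ≟ root (s e₂)) (root-source e₃ _ A₃ 3s)))

  record OtherEnd (e : Fin m) (v : Fin n) : Set where
    field
      y    : Fin n
      y≢v  : y ≢ v
      ι≡   : ∀ x → F.ι (s e) (t e) x ≡ F.ι v y x
      ends : s e ≡ v × t e ≡ y ⊎ s e ≡ y × t e ≡ v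

  other-end : ∀ e v → s e ≢ t e → Touches s t e v → OtherEnd e v
  other-end e v s≢t (inj₁ refl) = record
    { y = t e ; y≢v = s≢t ∘ sym ; ι≡ = λ _ → refl ; ends = inj₁ (refl , refl) }
  other-end e v s≢t (inj₂ refl) = record
    { y = s e ; y≢v = s≢t ; ι≡ = λ x → xor-comm (F.δ (s e) x) (F.δ (t e) x) ; ends = inj₂ (refl , refl) }

  -- If the other ends of e₁ and e₂ are joined in A − v (A without the edges at v), some cycle uses only e₁ and e₂
  -- at v; otherwise the edges of A meeting a component of A − v separate e₁ from e₂.
  even-set-at-star : ∀ A e₁ e₂ e₃ v → (∀ e → s e ≢ t e) → Even s t A →
    A e₁ ≡ true → A e₂ ≡ true → e₁ ≢ e₂ → e₁ ≢ e₃ → e₂ ≢ e₃ →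
    Touches s t e₁ v → Touches s t e₂ v → Touches s t e₃ v →
    ∃[ X ] Even s t X × X ⊆ A × X e₁ ≡ true × X e₂ ∧ X e₃ ≡ false
  even-set-at-star A e₁ e₂ e₃ v s≢t even A₁ A₂ 1≢2 1≢3 2≢3 at₁ at₂ at₃ = go (root y₁ ≟ root y₂)
    where
    B : Fin m → Bool
    B e = A e ∧ not (F.δ v (s e) ∨ F.δ v (t e))
    open Components (components s t B)
    open OtherEnd (other-end e₁ v (s≢t e₁) at₁) renaming (y to y₁; y≢v to y₁≢v; ι≡ to ι₁≡; ends to ends₁)
    open OtherEnd (other-end e₂ v (s≢t e₂) at₂) using () renaming (y to y₂; ι≡ to ι₂≡; ends to ends₂)

    B-misses : ∀ e → Touches s t e v → B e ≡ false
    B-misses e (inj₁ refl) rewrite δ-refl (s e) = ∧-zeroʳ (A e)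
    B-misses e (inj₂ refl) rewrite δ-refl (t e) = trans (cong (λ b → A e ∧ not b) (∨-zeroʳ (F.δ (t e) (s e)))) (∧-zeroʳ (A e))

    path-misses : ∀ x e → Touches s t e v → path x e ≡ false
    path-misses x e at-v = ⊆-refute (path⊆ x) e (B-misses e at-v)

    closing : Fin m → Bool
    closing e = (F.δ e₁ e xor F.δ e₂ e) xor (path y₁ e xor path y₂ e)

    closing-even : root y₁ ≡ root y₂ → Even s t closing
    closing-even 1~2 x = trans (F.∂-+ s t (λ e → F.δ e₁ e xor F.δ e₂ e) (λ e → path y₁ e xor path y₂ e) x)
      (trans (cong₂ _xor_
        (trans (F.∂-+ s t (F.δ e₁) (F.δ e₂) x)
          (cong₂ _xor_ (trans (F.∂-single s t e₁ x) (ι₁≡ x)) (trans (F.∂-single s t e₂ x) (ι₂≡ x))))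
        (trans (F.∂-+ s t (path y₁) (path y₂) x)
          (cong₂ _xor_ (trans (path-∂ y₁ x) (cong (λ r → F.ι y₁ r x) 1~2)) (path-∂ y₂ x))))
        (same⇒≡ _ _ (truth-table 4 (λ a b c d → same (((a xor b) xor (a xor c)) xor ((b xor d) xor (c xor d))) false) refl
          (F.δ v x) (F.δ y₁ x) (F.δ y₂ x) (F.δ (root y₂) x))))

    closing⊆ : closing ⊆ A
    closing⊆ e Xe with xor-cases (F.δ e₁ e xor F.δ e₂ e) _ Xe
    ... | inj₂ in-paths with xor-cases (path y₁ e) _ in-paths
    ...   | inj₁ in₁ = proj₁ (∧-true _ _ (path⊆ y₁ e in₁))
    ...   | inj₂ in₂ = proj₁ (∧-true _ _ (path⊆ y₂ e in₂))
    closing⊆ e Xe | inj₁ in-ends with e₁ ≟ e | e₂ ≟ e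
    ...   | yes refl | _        = A₁
    ...   | no _     | yes refl = A₂
    closing⊆ e Xe | inj₁ () | no _ | no _

    -- Chains in `B` avoid `v`, so only `e₁` and `e₂` remain there.
    closing-at-v : ∀ e → Touches s t e v → closing e ≡ F.δ e₁ e xor F.δ e₂ e
    closing-at-v e at-v rewrite path-misses y₁ e at-v | path-misses y₂ e at-v = xor-identityʳ _

    -- The component of `y₁` in A - v. Excluding `v` explicitly avoids having to compare its root
    -- with that of `y₁`.
    W : Fin n → Bool
    W x = does (root x ≟ root y₁) ∧ not (F.δ v x)

    W-v : W v ≡ false
    W-v = trans (cong (λ b → does (root v ≟ root y₁) ∧ not b) (δ-refl v)) (∧-zeroʳ _)

    W-y₁ : W y₁ ≡ true
    W-y₁ = cong₂ (λ b c → b ∧ not c) (dec-true (root y₁ ≟ root y₁) refl) (δ-≢ (y₁≢v ∘ sym))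

    W-adjacent : ∀ e → A e ≡ true → s e ≢ v → t e ≢ v → W (s e) ≡ W (t e)
    W-adjacent e Ae s≢v t≢v = cong₂ (λ r d → does (r ≟ root y₁) ∧ not d)
      (joined e (cong₂ _∧_ Ae (cong not (cong₂ _∨_ (δ-≢ (s≢v ∘ sym)) (δ-≢ (t≢v ∘ sym))))))
      (trans (δ-≢ (s≢v ∘ sym)) (sym (δ-≢ (t≢v ∘ sym))))

    K : Fin m → Bool
    K e = A e ∧ (W (s e) ∨ W (t e))

    K-inside : ∀ x → W x ≡ true → ∀ e → Touches s t e x → K e ≡ A e
    K-inside x Wx e (inj₁ refl) rewrite Wx = ∧-identityʳ (A e)
    K-inside x Wx e (inj₂ refl) rewrite Wx | ∨-zeroʳ (W (s e)) = ∧-identityʳ (A e)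

    K-outside : ∀ x → x ≢ v → W x ≡ false → ∀ e → Touches s t e x → K e ≡ false
    K-outside x x≢v Wx e at-x with A e in Ae
    ... | false = refl
    K-outside x x≢v Wx e (inj₁ refl) | true with t e ≟ v
    ... | yes t≡v = cong₂ _∨_ Wx (trans (cong W t≡v) W-v)
    ... | no  t≢v = cong₂ _∨_ Wx (trans (sym (W-adjacent e Ae x≢v t≢v)) Wx)
    K-outside x x≢v Wx e (inj₂ refl) | true with s e ≟ v
    ... | yes s≡v = cong₂ _∨_ (trans (cong W s≡v) W-v) Wx
    ... | no  s≢v = cong₂ _∨_ (trans (W-adjacent e Ae s≢v x≢v) Wx) Wx

    -- Away from `v`, all edges of `A` are kept at vertices of `W` and none at the others, since an
    -- edge of `A` off `v` does not leave `W`. The parity at `v` then follows by `handshake`.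
    K-even : Even s t K
    K-even = handshake K v (λ x x≢v → off-v x x≢v (W x) refl)
      where
      off-v : ∀ x → x ≢ v → ∀ b → W x ≡ b → F.∂ s t K x ≡ false
      off-v x x≢v true  Wx = trans (∂-local K A x (K-inside x Wx)) (even x)
      off-v x x≢v false Wx = trans (∂-local K (const false) x (K-outside x x≢v Wx)) (∅-even x)

    K-e₁ : K e₁ ≡ true
    K-e₁ = trans (K-inside y₁ W-y₁ e₁ (touches ends₁)) A₁
      where
      touches : s e₁ ≡ v × t e₁ ≡ y₁ ⊎ s e₁ ≡ y₁ × t e₁ ≡ v → Touches s t e₁ y₁
      touches (inj₁ (_ , t≡y)) = inj₂ t≡y
      touches (inj₂ (s≡y , _)) = inj₁ s≡y

    K-e₂ : root y₁ ≢ root y₂ → K e₂ ≡ false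
    K-e₂ 1≁2 = trans (cong (A e₂ ∧_) (misses ends₂)) (∧-zeroʳ (A e₂))
      where
      W-y₂ : W y₂ ≡ false
      W-y₂ = cong (_∧ not (F.δ v y₂)) (dec-false (root y₂ ≟ root y₁) (1≁2 ∘ sym))
      misses : s e₂ ≡ v × t e₂ ≡ y₂ ⊎ s e₂ ≡ y₂ × t e₂ ≡ v → W (s e₂) ∨ W (t e₂) ≡ false
      misses (inj₁ (s≡v , t≡y)) = cong₂ _∨_ (trans (cong W s≡v) W-v) (trans (cong W t≡y) W-y₂)
      misses (inj₂ (s≡y , t≡v)) = cong₂ _∨_ (trans (cong W s≡y) W-y₂) (trans (cong W t≡v) W-v)

    go : Dec (root y₁ ≡ root y₂) → ∃[ X ] Even s t X × X ⊆ A × X e₁ ≡ true × X e₂ ∧ X e₃ ≡ false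
    go (yes 1~2) = closing , closing-even 1~2 , closing⊆ ,
      trans (closing-at-v e₁ at₁) (cong₂ _xor_ (δ-refl e₁) (δ-≢ (1≢2 ∘ sym))) ,
      trans (cong (closing e₂ ∧_) (trans (closing-at-v e₃ at₃) (cong₂ _xor_ (δ-≢ 1≢3) (δ-≢ 2≢3)))) (∧-zeroʳ _)
    go (no 1≁2) = K , K-even , (λ e Ke → proj₁ (∧-true _ _ Ke)) , K-e₁ , cong (_∧ K e₃) (K-e₂ 1≁2)

-- The common edges

-- Elements are removed one at a time; once nothing else is left, the last one found pads the
-- vector.
enumerate : ∀ {m} k (S : Subset m) → ∣ S ∣ ≤ suc k → ∀ x → x ∈ S →
  ∃[ xs ] (∀ i → lookup {n = suc k} xs i ∈ S) × (∀ y → y ∈ S → ∃[ i ] y ≡ lookup xs i)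
enumerate {m} k S bound x x∈S with nonempty? (S without x)
... | no empty = replicate (suc k) x , (λ i → subst (_∈ S) (sym (lookup-replicate i x)) x∈S) ,
  λ y y∈S → zero , only y y∈S (y ≟ x)
  where
  only : ∀ y → y ∈ S → Dec (y ≡ x) → y ≡ x
  only y y∈S (yes y≡x) = y≡x
  only y y∈S (no  y≢x) = contradiction (y , x∈p∧x≢y⇒x∈p-y y∈S y≢x) empty
enumerate zero S bound x x∈S | yes (y , y∈S-x) with ≤-trans (x∈p⇒∣p-x∣<∣p∣ x∈S) bound
... | s≤s size≤0 with ≤-trans (x∈p⇒∣p-x∣<∣p∣ y∈S-x) size≤0
... | ()
enumerate (suc k) S bound x x∈S | yes (y , y∈S-x)
  with enumerate k (S without x) (≤-pred (≤-trans (x∈p⇒∣p-x∣<∣p∣ x∈S) bound)) y y∈S-x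
... | xs , xs⊆ , covers = x ∷ xs , members , covers′
  where
  members : ∀ i → lookup (x ∷ xs) i ∈ S
  members zero    = x∈S
  members (suc i) = p─q⊆p S _ (xs⊆ i)
  covers′ : ∀ z → z ∈ S → ∃[ i ] z ≡ lookup (x ∷ xs) i
  covers′ z z∈S with z ≟ x
  ... | yes z≡x = zero , z≡x
  ... | no  z≢x with covers z (x∈p∧x≢y⇒x∈p-y z∈S z≢x)
  ...   | i , eq = suc i , eq

-- Repetitions are allowed, so that one, two and three common edges are treated alike. In the
-- degenerate case the injective flow makes the edges distinct.
record Triple {m} (S : Subset m) : Set where
  field
    e₁ e₂ e₃ : Fin m
    e₁∈ : e₁ ∈ S
    e₂∈ : e₂ ∈ S
    e₃∈ : e₃ ∈ S
    covers : ∀ e → e ∈ S → e ≡ e₁ ⊎ e ≡ e₂ ⊎ e ≡ e₃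

rotate : ∀ {m} {S : Subset m} → Triple S → Triple S
rotate T = record { e₁ = e₂ ; e₂ = e₃ ; e₃ = e₁ ; e₁∈ = e₂∈ ; e₂∈ = e₃∈ ; e₃∈ = e₁∈
                  ; covers = λ e e∈S → cycle (covers e e∈S) }
  where
  open Triple T
  cycle : ∀ {A B C : Set} → A ⊎ B ⊎ C → B ⊎ C ⊎ A
  cycle (inj₁ a)        = inj₂ (inj₂ a)
  cycle (inj₂ (inj₁ b)) = inj₁ b
  cycle (inj₂ (inj₂ c)) = inj₂ (inj₁ c)

triple : ∀ {m} (S : Subset m) → ∣ S ∣ ≤ 3 → ∀ x → x ∈ S → Triple S
triple S bound x x∈S with enumerate 2 S bound x x∈S
... | (a ∷ b ∷ c ∷ []) , members , covers = record
  { e₁ = a ; e₂ = b ; e₃ = c ; e₁∈ = members zero ; e₂∈ = members (suc zero) ; e₃∈ = members (suc (suc zero))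
  ; covers = λ e e∈S → split (covers e e∈S) }
  where
  split : ∀ {e} → ∃[ i ] e ≡ lookup (a ∷ b ∷ c ∷ []) i → e ≡ a ⊎ e ≡ b ⊎ e ≡ c
  split (zero , eq)           = inj₁ eq
  split (suc zero , eq)       = inj₂ (inj₁ eq)
  split (suc (suc zero) , eq) = inj₂ (inj₂ eq)

Distinct : ∀ {m} {S : Subset m} → Triple S → Set
Distinct T = e₁ ≢ e₂ × e₂ ≢ e₃ × e₃ ≢ e₁
  where open Triple T

module Adjacency (Γ : Graph) (S : Subset (m Γ)) where
  private
    s = source Γ
    t = target Γ

  Shared : Fin (m Γ) → Fin (n Γ) → Set
  Shared e v = ∃[ e′ ] (e′ ∈ S × e′ ≢ e × Touches s t e′ v)

  shared? : ∀ e v → Dec (Shared e v)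
  shared? e v = any? λ e′ → (e′ ∈? S) ×-dec (¬? (e′ ≟ e) ×-dec ((s e′ ≟ v) ⊎-dec (t e′ ≟ v)))

  -- Besides the inner edge of a path this covers the edges of a triangle and parallel edges, since
  -- one other edge may serve both ends.
  Middle : Fin (m Γ) → Set
  Middle e = Shared e (s e) × Shared e (t e)

  middle? : ∀ e → Dec (Middle e)
  middle? e = shared? e (s e) ×-dec shared? e (t e)

  -- Follow the walk: steps along `e` stay at its ends, and the first step along another edge, or
  -- else the arrival at `e′`, happens at a shared end.
  shared-end : ∀ e e′ → e′ ∈ S → e′ ≢ e → ∀ u v → Touches s t e u → Touches s t e′ v → Reach Γ S u v →
               ∃[ z ] (Touches s t e z × Shared e z)
  shared-end e e′ e′∈S e′≢e u .u at-u at-v here = u , at-u , e′ , e′∈S , e′≢e , at-v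
  shared-end e e′ e′∈S e′≢e u v at-u at-v (step {w = w} f f∈S ends reach) with f ≟ e
  ... | yes refl = shared-end e e′ e′∈S e′≢e w v (far ends) at-v reach
    where
    far : (s f ≡ u × t f ≡ w) ⊎ (t f ≡ u × s f ≡ w) → Touches s t f w
    far (inj₁ (_ , t≡w)) = inj₂ t≡w
    far (inj₂ (_ , s≡w)) = inj₁ s≡w
  ... | no f≢e = u , at-u , f , f∈S , f≢e , map-⊎ proj₁ proj₁ ends

  shared-end-unique : ∀ e → ¬ Middle e → ∀ u v → Touches s t e u → Shared e u → Touches s t e v → Shared e v → u ≡ v
  shared-end-unique e ¬mid u v (inj₁ refl) _  (inj₁ refl) _  = refl
  shared-end-unique e ¬mid u v (inj₁ refl) su (inj₂ refl) sv = contradiction (su , sv) ¬mid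
  shared-end-unique e ¬mid u v (inj₂ refl) su (inj₁ refl) sv = contradiction (sv , su) ¬mid
  shared-end-unique e ¬mid u v (inj₂ refl) _  (inj₂ refl) _  = refl

  Common : Triple S → Set
  Common T = ∃[ v ] (Touches s t e₁ v × Touches s t e₂ v × Touches s t e₃ v)
    where open Triple T

  -- If no edge is in the middle, each has exactly one shared end, and any two edges that meet do so
  -- in the shared end of both.
  path-or-star : InducesConnected Γ S → (T : Triple S) → Distinct T →
    Middle (Triple.e₁ T) ⊎ Middle (Triple.e₂ T) ⊎ Middle (Triple.e₃ T) ⊎ Common T
  path-or-star connected T (1≢2 , 2≢3 , 3≢1) with middle? (Triple.e₁ T) | middle? (Triple.e₂ T) | middle? (Triple.e₃ T)
  ... | yes mid | _       | _       = inj₁ mid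
  ... | no _    | yes mid | _       = inj₂ (inj₁ mid)
  ... | no _    | no _    | yes mid = inj₂ (inj₂ (inj₁ mid))
  ... | no ¬m₁  | no ¬m₂  | no ¬m₃  = inj₂ (inj₂ (inj₂ common))
    where
    open Triple T
    end : ∀ e e′ → e ∈ S → e′ ∈ S → e′ ≢ e → ∃[ z ] (Touches s t e z × Shared e z)
    end e e′ e∈S e′∈S e′≢e = shared-end e e′ e′∈S e′≢e (s e) (s e′) (inj₁ refl) (inj₁ refl)
      (connected (s e) (s e′) (e , e∈S , inj₁ refl) (e′ , e′∈S , inj₁ refl))

    meet : ∀ {e e′ x z z′} → e ∈ S → e′ ∈ S → e ≢ e′ → ¬ Middle e → ¬ Middle e′ →
           Touches s t e x → Touches s t e′ x →
           Touches s t e z × Shared e z → Touches s t e′ z′ × Shared e′ z′ → z ≡ z′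
    meet e∈S e′∈S e≢e′ ¬m ¬m′ at at′ (at-z , sh-z) (at-z′ , sh-z′) = trans
      (shared-end-unique _ ¬m _ _ at-z sh-z at (_ , e′∈S , e≢e′ ∘ sym , at′))
      (shared-end-unique _ ¬m′ _ _ at′ (_ , e∈S , e≢e′ , at) at-z′ sh-z′)

    common : Common T
    common with end e₁ e₂ e₁∈ e₂∈ (1≢2 ∘ sym) | end e₂ e₁ e₂∈ e₁∈ 1≢2 | end e₃ e₁ e₃∈ e₁∈ (3≢1 ∘ sym)
    ... | z₁ , E₁@(at₁ , f₁ , f₁∈ , f₁≢ , f₁-at) | z₂ , E₂@(at₂ , f₂ , f₂∈ , f₂≢ , f₂-at)
        | z₃ , E₃@(at₃ , f₃ , f₃∈ , f₃≢ , f₃-at)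
      = conclude meets₁ meets₂ meets₃
      where
      meets₁ : z₁ ≡ z₂ ⊎ z₁ ≡ z₃
      meets₁ with covers f₁ f₁∈
      ... | inj₁ f≡1         = contradiction f≡1 f₁≢
      ... | inj₂ (inj₁ refl) = inj₁ (meet e₁∈ e₂∈ 1≢2 ¬m₁ ¬m₂ at₁ f₁-at E₁ E₂)
      ... | inj₂ (inj₂ refl) = inj₂ (meet e₁∈ e₃∈ (3≢1 ∘ sym) ¬m₁ ¬m₃ at₁ f₁-at E₁ E₃)

      meets₂ : z₁ ≡ z₂ ⊎ z₂ ≡ z₃
      meets₂ with covers f₂ f₂∈
      ... | inj₁ refl        = inj₁ (meet e₁∈ e₂∈ 1≢2 ¬m₁ ¬m₂ f₂-at at₂ E₁ E₂)
      ... | inj₂ (inj₁ f≡2)  = contradiction f≡2 f₂≢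
      ... | inj₂ (inj₂ refl) = inj₂ (meet e₂∈ e₃∈ 2≢3 ¬m₂ ¬m₃ at₂ f₂-at E₂ E₃)

      meets₃ : z₁ ≡ z₃ ⊎ z₂ ≡ z₃
      meets₃ with covers f₃ f₃∈
      ... | inj₁ refl        = inj₁ (meet e₁∈ e₃∈ (3≢1 ∘ sym) ¬m₁ ¬m₃ f₃-at at₃ E₁ E₃)
      ... | inj₂ (inj₁ refl) = inj₂ (meet e₂∈ e₃∈ 2≢3 ¬m₂ ¬m₃ f₃-at at₃ E₂ E₃)
      ... | inj₂ (inj₂ f≡3)  = contradiction f≡3 f₃≢

      -- Each of the three vertices equals one of the other two, which makes all of them equal.
      conclude : z₁ ≡ z₂ ⊎ z₁ ≡ z₃ → z₁ ≡ z₂ ⊎ z₂ ≡ z₃ → z₁ ≡ z₃ ⊎ z₂ ≡ z₃ → Common T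
      conclude (inj₁ refl) _           (inj₁ refl) = z₁ , at₁ , at₂ , at₃
      conclude (inj₁ refl) _           (inj₂ refl) = z₁ , at₁ , at₂ , at₃
      conclude (inj₂ refl) (inj₁ refl) _           = z₁ , at₁ , at₂ , at₃
      conclude (inj₂ refl) (inj₂ refl) _           = z₁ , at₁ , at₂ , at₃

-- Combining the two flows

module Merge (Γ : Graph) (E₁ E₂ : Subset (m Γ)) (E-cover : E₁ ∪ E₂ ≡ ⊤) where
  private
    s = source Γ
    t = target Γ
    S = E₁ ∩ E₂

  -- Zeros are tolerated on E ∩ E′, where the other flow can repair them.
  record PartialFlow (E E′ : Subset (m Γ)) (φ : Fin (m Γ) → V4) : Set where
    field
      cycle     : Cycle s t φ
      vanish    : ∀ e → e ∉ E → φ e ≡ 0V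
      nowhere-0 : ∀ e → e ∈ E → e ∉ E′ → nz (φ e) ≡ true

  cycle-shift : ∀ φ X c → Cycle s t φ → Even s t X → Cycle s t (λ e → φ e ⊕ X e · c)
  cycle-shift φ X (c , d) (even₁ , even₂) X-even =
    even-xor s t _ (λ e → X e ∧ c) even₁ (scale c) , even-xor s t _ (λ e → X e ∧ d) even₂ (scale d)
    where
    scale : ∀ c → Even s t (λ e → X e ∧ c)
    scale c v = trans (F.sum-cong-≗ (λ e → cong (_∧ F.ι (s e) (t e) v) (∧-comm (X e) c))) (even-scale s t c X X-even v)

  ω-even : ∀ φ c → Cycle s t φ → Even s t (λ e → ω (φ e) c)
  ω-even φ (c , d) (even₁ , even₂) = even-xor s t _ _ (even-scale s t d _ even₁) (even-scale s t c _ even₂)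

  linear-cycle : ∀ α β γ δ φ → Cycle s t φ → Cycle s t (linear α β γ δ ∘ φ)
  linear-cycle α β γ δ φ (even₁ , even₂) =
    even-xor s t _ _ (even-scale s t α _ even₁) (even-scale s t β _ even₂) ,
    even-xor s t _ _ (even-scale s t γ _ even₁) (even-scale s t δ _ even₂)

  -- Off the common edges only one summand survives, and an invertible matrix keeps a nonzero value
  -- nonzero; so only `S` needs the hypothesis `apart`.
  merge : ∀ {φ₁ φ₂} → PartialFlow E₁ E₂ φ₁ → PartialFlow E₂ E₁ φ₂ → ∀ α β γ δ → det α β γ δ ≡ true →
          (∀ e → e ∈ S → nz (φ₁ e ⊕ linear α β γ δ (φ₂ e)) ≡ true) → V4Flow Γ ⊤
  merge {φ₁} {φ₂} f₁ f₂ α β γ δ regular apart = (λ e → φ₁ e ⊕ linear α β γ δ (φ₂ e)) , record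
    { cycle = even-xor s t _ _ (proj₁ c₁) (proj₁ c₂) , even-xor s t _ _ (proj₂ c₁) (proj₂ c₂)
    ; vanish = λ e e∉⊤ → contradiction ∈⊤ e∉⊤
    ; nowhere-0 = λ e _ → nonzero e (e ∈? E₁) (e ∈? E₂) }
    where
    module f₁ = PartialFlow f₁
    module f₂ = PartialFlow f₂
    c₁ = f₁.cycle
    c₂ = linear-cycle α β γ δ φ₂ f₂.cycle

    nonzero : ∀ e → Dec (e ∈ E₁) → Dec (e ∈ E₂) → nz (φ₁ e ⊕ linear α β γ δ (φ₂ e)) ≡ true
    nonzero e (yes e∈₁) (yes e∈₂) = apart e (x∈p∩q⁺ (e∈₁ , e∈₂))
    nonzero e (yes e∈₁) (no e∉₂)  =
      trans (cong (λ b → nz (φ₁ e ⊕ linear α β γ δ b)) (f₂.vanish e e∉₂))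
        (trans (cong nz (linear-0 α β γ δ (φ₁ e))) (f₁.nowhere-0 e e∈₁ e∉₂))
      where
      linear-0 : ∀ α β γ δ a → a ⊕ linear α β γ δ 0V ≡ a
      linear-0 α β γ δ (p , q) = cong₂ _,_ (zero-row α β p) (zero-row γ δ q)
        where
        zero-row : ∀ α β p → p xor ((α ∧ false) xor (β ∧ false)) ≡ p
        zero-row α β p = same⇒≡ _ _ (truth-table 3 (λ α β p → same (p xor ((α ∧ false) xor (β ∧ false))) p) refl α β p)
    nonzero e (no e∉₁)  (yes e∈₂) =
      trans (cong (λ a → nz (a ⊕ linear α β γ δ (φ₂ e))) (f₁.vanish e e∉₁))
        (linear-nz α β γ δ (φ₂ e) ⟨⇒⟩ regular ⟨⇒⟩ f₂.nowhere-0 e e∈₂ e∉₁)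
    nonzero e (no e∉₁)  (no e∉₂)  with x∈p∪q⁻ E₁ E₂ (subst (e ∈_) (sym E-cover) ∈⊤)
    ... | inj₁ e∈₁ = contradiction e∈₁ e∉₁
    ... | inj₂ e∈₂ = contradiction e∈₂ e∉₂

  module _ {φ₁ φ₂} (f₁ : PartialFlow E₁ E₂ φ₁) (f₂ : PartialFlow E₂ E₁ φ₂) (T : Triple S) where
    open Triple T

    merge-compatible : compatible (φ₁ e₁) (φ₁ e₂) (φ₁ e₃) (φ₂ e₁) (φ₂ e₂) (φ₂ e₃) ≡ true →
                       V4Flow Γ ⊤
    merge-compatible ok with search-sound 4
        (λ α β γ δ → avoids α β γ δ (φ₁ e₁) (φ₁ e₂) (φ₁ e₃) (φ₂ e₁) (φ₂ e₂) (φ₂ e₃)) ok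
    ... | α , β , γ , δ , sep with ∧-true (det α β γ δ) _ sep
    ... | regular , rest with ∧-true (nz (φ₁ e₁ ⊕ linear α β γ δ (φ₂ e₁))) _ rest
    ... | apart₁ , rest′ with ∧-true (nz (φ₁ e₂ ⊕ linear α β γ δ (φ₂ e₂))) _ rest′
    ... | apart₂ , apart₃ = merge f₁ f₂ α β γ δ regular apart
      where
      apart : ∀ e → e ∈ S → nz (φ₁ e ⊕ linear α β γ δ (φ₂ e)) ≡ true
      apart e e∈S with covers e e∈S
      ... | inj₁ refl        = apart₁
      ... | inj₂ (inj₁ refl) = apart₂
      ... | inj₂ (inj₂ refl) = apart₃

  -- Outside `E` the form `ω` is zero, so `X` is empty there and the support stays in `E`. On edges
  -- of `E` alone `X` lies where adding `c` is harmless. On common edges `X` is unrestricted.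
  shift : ∀ {E E′ φ} → NowhereZero s t E φ → ∀ c X → Even s t X →
          (∀ e → e ∉ E ⊎ e ∉ E′ → X e ≡ true → ω (φ e) c ≡ true) →
          PartialFlow E E′ (λ e → φ e ⊕ X e · c)
  shift {E} {E′} {φ} f c X X-even X⊆ω = record
    { cycle = cycle-shift φ X c cycle X-even
    ; vanish = outside
    ; nowhere-0 = λ e e∈E e∉E′ →
        shift-nz (X e) (φ e) c ⟨⇒⟩ nowhere-0 e e∈E ⟨⇒⟩ implies (X⊆ω e (inj₂ e∉E′)) }
    where
    open NowhereZero f
    implies : ∀ {x y} → (x ≡ true → y ≡ true) → (x ⇒ y) ≡ true
    implies {false} _ = refl
    implies {true}  h = h refl
    outside : ∀ e → e ∉ E → φ e ⊕ X e · c ≡ 0V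
    outside e e∉E with X e | X⊆ω e (inj₁ e∉E)
    ... | false | _  rewrite vanish e e∉E = refl
    ... | true  | in-ω rewrite vanish e e∉E = contradiction (trans (sym (ω-0 c)) (in-ω refl)) λ ()
      where
      ω-0 : ∀ c → ω 0V c ≡ false
      ω-0 (p , q) = cong₂ _xor_ (∧-zeroʳ q) (∧-zeroʳ p)

  to-partial : ∀ {E E′ φ} → NowhereZero s t E φ → PartialFlow E E′ φ
  to-partial f = record { cycle = cycle ; vanish = vanish ; nowhere-0 = λ e e∈E _ → nowhere-0 e e∈E }
    where open NowhereZero f

  module Degenerate {φ₁ φ₂} (f₁ : NowhereZero s t E₁ φ₁) (f₂ : NowhereZero s t E₂ φ₂) where
    private
      module f₁ = NowhereZero f₁
      module f₂ = NowhereZero f₂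
    open Adjacency Γ S

    IsConstant IsDistinct : Triple S → Set
    IsConstant T = constant (φ₁ e₁) (φ₁ e₂) (φ₁ e₃) ≡ true
      where open Triple T
    IsDistinct T = distinct (φ₂ e₁) (φ₂ e₂) (φ₂ e₃) ≡ true
      where open Triple T

    nz₁ : ∀ e → e ∈ S → nz (φ₁ e) ≡ true
    nz₁ e e∈S = f₁.nowhere-0 e (proj₁ (x∈p∩q⁻ E₁ E₂ e∈S))

    nz₂ : ∀ e → e ∈ S → nz (φ₂ e) ≡ true
    nz₂ e e∈S = f₂.nowhere-0 e (proj₂ (x∈p∩q⁻ E₁ E₂ e∈S))

    -- Adding φ₂ e₂ along X makes e₂ a zero of the second flow or gives two of the edges the same value.
    merge-path : (T : Triple S) → IsConstant T → IsDistinct T → Middle (Triple.e₂ T) → V4Flow Γ ⊤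
    merge-path T const₁ dist₂ (at-s , at-t) = result
      where
      open Triple T
      b₁ = φ₂ e₁; b₂ = φ₂ e₂; b₃ = φ₂ e₃

      A : Fin (m Γ) → Bool
      A e = ω (φ₂ e) b₂

      A-values : A e₁ ∧ not (A e₂) ∧ A e₃ ≡ true
      A-values = ω-distinct b₁ b₂ b₃ ⟨⇒⟩ nz₂ e₁ e₁∈ ⟨⇒⟩ nz₂ e₂ e₂∈ ⟨⇒⟩ nz₂ e₃ e₃∈ ⟨⇒⟩ dist₂

      not-true : ∀ {x} → not x ≡ true → x ≡ false
      not-true {false} _ = refl

      neighbour : ∀ {v} → Shared e₂ v → Touches s t e₁ v ⊎ Touches s t e₃ v
      neighbour (e , e∈S , e≢e₂ , at) with covers e e∈S
      ... | inj₁ refl        = inj₁ at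
      ... | inj₂ (inj₁ refl) = contradiction refl e≢e₂
      ... | inj₂ (inj₂ refl) = inj₂ at

      result : V4Flow Γ ⊤
      result with ∧-true (A e₁) _ A-values
      ... | A₁ , rest with ∧-true (not (A e₂)) _ rest
      ... | A₂ , A₃ with even-set-near-path s t A e₁ e₂ e₃ (ω-even φ₂ b₂ f₂.cycle)
                           A₁ (not-true A₂) A₃ (neighbour at-s) (neighbour at-t)
      ... | X , X-even , X⊆A , X-useful = merge-compatible (to-partial f₁) (shift f₂ b₂ X X-even inside) T compat
        where
        -- Only at `e₂` may `X` leave `A`, and `e₂` lies in both parts.
        inside : ∀ e → e ∉ E₂ ⊎ e ∉ E₁ → X e ≡ true → A e ≡ true
        inside e outside = X⊆A e (λ { refl → not-shared outside })
          where
          not-shared : ¬ (e₂ ∉ E₂ ⊎ e₂ ∉ E₁)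
          not-shared (inj₁ ∉₂) = ∉₂ (proj₂ (x∈p∩q⁻ E₁ E₂ e₂∈))
          not-shared (inj₂ ∉₁) = ∉₁ (proj₁ (x∈p∩q⁻ E₁ E₂ e₂∈))

        compat : compatible (φ₁ e₁) (φ₁ e₂) (φ₁ e₃) (b₁ ⊕ X e₁ · b₂) (b₂ ⊕ X e₂ · b₂) (b₃ ⊕ X e₃ · b₂) ≡ true
        compat rewrite proj₁ (constant⇒≡ (φ₁ e₁) (φ₁ e₂) (φ₁ e₃) const₁)
                     | proj₂ (constant⇒≡ (φ₁ e₁) (φ₁ e₂) (φ₁ e₃) const₁) =
          path-table (φ₁ e₁) b₁ b₂ b₃ (X e₁) (X e₂) (X e₃)
            ⟨⇒⟩ nz₁ e₁ e₁∈ ⟨⇒⟩ nz₂ e₁ e₁∈ ⟨⇒⟩ nz₂ e₂ e₂∈ ⟨⇒⟩ nz₂ e₃ e₃∈ ⟨⇒⟩ dist₂ ⟨⇒⟩ X-useful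

    -- Adding partner (φ₁ e₁) along X makes φ₁ non-constant on the three edges.
    merge-star : (T : Triple S) → IsConstant T → IsDistinct T → Common T → V4Flow Γ ⊤
    merge-star T const₁ dist₂ (v , at₁ , at₂ , at₃) = result
      where
      open Triple T
      a = φ₁ e₁
      c = partner a
      edges≢ = distinct⇒≢ φ₂ e₁ e₂ e₃ dist₂
      2≡1 = proj₁ (constant⇒≡ a (φ₁ e₂) (φ₁ e₃) const₁)
      3≡1 = proj₂ (constant⇒≡ a (φ₁ e₂) (φ₁ e₃) const₁)

      A : Fin (m Γ) → Bool
      A e = ω (φ₁ e) c

      A₁ : A e₁ ≡ true
      A₁ = ω-partner a (nz₁ e₁ e₁∈)

      result : V4Flow Γ ⊤
      result with even-set-at-star s t A e₁ e₂ e₃ v (loopless Γ) (ω-even φ₁ c f₁.cycle)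
                    A₁ (trans (cong (λ b → ω b c) 2≡1) A₁)
                    (proj₁ edges≢) (proj₂ (proj₂ edges≢) ∘ sym) (proj₁ (proj₂ edges≢)) at₁ at₂ at₃
      ... | X , X-even , X⊆A , X₁ , X₂₃ = merge-compatible (shift f₁ c X X-even (λ e _ → X⊆A e)) (to-partial f₂) T compat
        where
        compat : compatible (a ⊕ X e₁ · c) (φ₁ e₂ ⊕ X e₂ · c) (φ₁ e₃ ⊕ X e₃ · c)
                            (φ₂ e₁) (φ₂ e₂) (φ₂ e₃) ≡ true
        compat rewrite 2≡1 | 3≡1 =
          star-table a (φ₂ e₁) (φ₂ e₂) (φ₂ e₃) (X e₁) (X e₂) (X e₃)
            ⟨⇒⟩ nz₁ e₁ e₁∈ ⟨⇒⟩ nz₂ e₁ e₁∈ ⟨⇒⟩ nz₂ e₂ e₂∈ ⟨⇒⟩ nz₂ e₃ e₃∈ ⟨⇒⟩ dist₂ ⟨⇒⟩ X₁ ⟨⇒⟩ cong not X₂₃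

    merge-degenerate : InducesConnected Γ S → (T : Triple S) → IsConstant T → IsDistinct T → V4Flow Γ ⊤
    merge-degenerate connected T const₁ dist₂ =
      split (path-or-star connected T (distinct⇒≢ φ₂ e₁ e₂ e₃ dist₂))
      where
      open Triple T
      rotate-constant : ∀ T → IsConstant T → IsConstant (rotate T)
      rotate-constant T = constant-rotate (φ₁ (Triple.e₁ T)) (φ₁ (Triple.e₂ T)) (φ₁ (Triple.e₃ T))
      rotate-distinct : ∀ T → IsDistinct T → IsDistinct (rotate T)
      rotate-distinct T = distinct-rotate (φ₂ (Triple.e₁ T)) (φ₂ (Triple.e₂ T)) (φ₂ (Triple.e₃ T))
      -- `merge-path` expects the middle edge in second place; there `T′` has `e₃` and `T″` has
      -- `e₁`.
      T′ = rotate T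
      T″ = rotate T′
      split : Middle e₁ ⊎ Middle e₂ ⊎ Middle e₃ ⊎ Common T → V4Flow Γ ⊤
      split (inj₁ mid₁) = merge-path T″ (rotate-constant T′ (rotate-constant T const₁))
                                        (rotate-distinct T′ (rotate-distinct T dist₂)) mid₁
      split (inj₂ (inj₁ mid₂)) = merge-path T const₁ dist₂ mid₂
      split (inj₂ (inj₂ (inj₁ mid₃))) = merge-path T′ (rotate-constant T const₁) (rotate-distinct T dist₂) mid₃
      split (inj₂ (inj₂ (inj₂ common))) = merge-star T const₁ dist₂ common

merge-V4Flows : (Γ : Graph) (E₁ E₂ : Subset (m Γ)) → E₁ ∪ E₂ ≡ ⊤ → ∣ E₁ ∩ E₂ ∣ ≤ 3 →
                InducesConnected Γ (E₁ ∩ E₂) → V4Flow Γ E₁ → V4Flow Γ E₂ → V4Flow Γ ⊤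
merge-V4Flows Γ E₁ E₂ cover bound connected (φ₁ , f₁) (φ₂ , f₂) with nonempty? (E₁ ∩ E₂)
-- Without common edges the identity matrix serves.
... | no disjoint = merge (to-partial f₁) (to-partial f₂) true false false true refl
                      (λ e e∈S → contradiction (e , e∈S) disjoint)
  where open Merge Γ E₁ E₂ cover
... | yes (e , e∈S) = split (∨-cases _ _ alternatives)
  where
  module M = Merge Γ E₁ E₂ cover
  module M′ = Merge Γ E₂ E₁ (trans (∪-comm E₂ E₁) cover)
  open M.Degenerate f₁ f₂ using (nz₁; nz₂)
  T = triple (E₁ ∩ E₂) bound e e∈S
  open Triple T
  a₁ = φ₁ e₁; a₂ = φ₁ e₂; a₃ = φ₁ e₃; b₁ = φ₂ e₁; b₂ = φ₂ e₂; b₃ = φ₂ e₃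

  alternatives : compatible a₁ a₂ a₃ b₁ b₂ b₃ ∨
                 (constant a₁ a₂ a₃ ∧ distinct b₁ b₂ b₃) ∨ (constant b₁ b₂ b₃ ∧ distinct a₁ a₂ a₃) ≡ true
  alternatives = compatible-or-degenerate a₁ a₂ a₃ b₁ b₂ b₃
    ⟨⇒⟩ nz₁ e₁ e₁∈ ⟨⇒⟩ nz₁ e₂ e₂∈ ⟨⇒⟩ nz₁ e₃ e₃∈ ⟨⇒⟩ nz₂ e₁ e₁∈ ⟨⇒⟩ nz₂ e₂ e₂∈ ⟨⇒⟩ nz₂ e₃ e₃∈

  split : compatible a₁ a₂ a₃ b₁ b₂ b₃ ≡ true ⊎
          (constant a₁ a₂ a₃ ∧ distinct b₁ b₂ b₃) ∨ (constant b₁ b₂ b₃ ∧ distinct a₁ a₂ a₃) ≡ true →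
          V4Flow Γ ⊤
  split (inj₁ ok) = M.merge-compatible (M.to-partial f₁) (M.to-partial f₂) T ok
  split (inj₂ degenerate) with ∨-cases (constant a₁ a₂ a₃ ∧ distinct b₁ b₂ b₃) _ degenerate
  ... | inj₁ first with ∧-true (constant a₁ a₂ a₃) _ first
  ...   | const₁ , dist₂ = M.Degenerate.merge-degenerate f₁ f₂ connected T const₁ dist₂
  split (inj₂ degenerate) | inj₂ second with ∧-true (constant b₁ b₂ b₃) _ second
  -- The mirror case: the same argument with the two parts exchanged.
  ...   | const₂ , dist₁ = M′.Degenerate.merge-degenerate f₂ f₁ (subst (InducesConnected Γ) (∩-comm E₁ E₂) connected)
                             T′ const₂ dist₁
    where
    T′ : Triple (E₂ ∩ E₁)
    T′ = record { e₁ = e₁ ; e₂ = e₂ ; e₃ = e₃ ; e₁∈ = flip e₁∈ ; e₂∈ = flip e₂∈ ; e₃∈ = flip e₃∈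
                ; covers = λ e e∈ → covers e (subst (e ∈_) (∩-comm E₂ E₁) e∈) }
      where
      flip : ∀ {e} → e ∈ E₁ ∩ E₂ → e ∈ E₂ ∩ E₁
      flip {e} = subst (e ∈_) (∩-comm E₁ E₂)

theorem4p2 : (Γ : Graph) (Γ₁ Γ₂ : Subgraph Γ) →
    V Γ₁ ∪ V Γ₂ ≡ ⊤ → E Γ₁ ∪ E Γ₂ ≡ ⊤ →
    ∣ E Γ₁ ∩ E Γ₂ ∣ ≤ 3 →
    InducesConnected Γ (E Γ₁ ∩ E Γ₂) →
    NZ4Flow Γ Γ₁ → NZ4Flow Γ Γ₂ → NZ4Flow Γ (whole Γ)
theorem4p2 Γ Γ₁ Γ₂ _ E-cover bound connected flow₁ flow₂ = from-V4Flow Γ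
  (merge-V4Flows Γ (E Γ₁) (E Γ₂) E-cover bound connected (to-V4Flow Γ Γ₁ flow₁) (to-V4Flow Γ Γ₂ flow₂))
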